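{- Let $T$ be a reflexive tree and let $\phi:E(T)\to\mathbb{Z}$ be an assignment of integers to the edges of $T$ that is positive on every loop. Suppose there is a vertex $v\in V(T)$ such that $\phi(u)=\phi(v)$ for every neighbor $u$ of $v$. Then there exists $N$ such that for every prime $p\ge N$, the covering graph $T^{\sigma}$ (with $\sigma$ the voltage assignment into $\mathbb{Z}_p$ induced by $\phi$) is Hamiltonian.
   Context: A reflexive tree is a tree with exactly one loop added at every vertex; $\phi(w)$ denotes the integer assigned to the loop at $w$. For a prime $p$, the voltage assignment $\sigma$ into $\mathbb{Z}_p$ is defined by giving each edge $e$ a fixed orientation with arcs $e^+,e^-$ (for a loop, the primary and secondary arc) and setting $\sigma(e^+)=\phi(e)\bmod p$, $\sigma(e^-)=-\phi(e)\bmod p$. The lift $T^\sigma$ has vertex set $V(T)\times\mathbb{Z}_p$, with $(u,a)$ adjacent to $(w,b)$ iff some arc $(u,w)$ has $\sigma(u,w)=b-a$. -}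

module Defs where

open import Data.Nat using (ℕ; _≤_)
open import Data.Integer as ℤ using (ℤ; +_; +0; _-_; -_)
open import Data.Integer.Divisibility using () renaming (_∣_ to _∣ℤ_)
open import Data.Fin using (Fin; toℕ)
open import Data.Product using (_×_; _,_; ∃; ∃-syntax; Σ-syntax)
open import Data.Sum using (_⊎_)
open import Data.Unit using (⊤)
open import Data.Empty using (⊥)
open import Data.List using (List; []; _∷_; _++_; [_]; length)
open import Data.List.Membership.Propositional using (_∈_)
open import Data.List.Relation.Unary.Unique.Propositional using (Unique)
open import Relation.Binary.PropositionalEquality using (_≡_)

-- A reflexive (multi)graph on vertex set Fin n with m non-loop edges.
-- Edge e has a fixed orientation: ends e = (tail, head), i.e. arc e⁺
-- goes from tail to head and e⁻ from head to tail.  In addition every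
-- vertex carries exactly one loop.  φ assigns an integer to each edge
-- and to each loop.

record ReflexiveGraph (n m : ℕ) : Set where
  field
    ends  : Fin m → Fin n × Fin n
    φe    : Fin m → ℤ
    φl    : Fin n → ℤ

module _ {n m : ℕ} (G : ReflexiveGraph n m) where
  open ReflexiveGraph G

  Joins : Fin m → Fin n → Fin n → Set
  Joins e x y = (ends e ≡ (x , y)) ⊎ (ends e ≡ (y , x))

  data Walk : Fin n → Fin n → List (Fin m) → Set where
    nil  : ∀ {u} → Walk u u []
    step : ∀ {u w x es} (e : Fin m) → Joins e u w → Walk w x es → Walk u x (e ∷ es)

  NoSelfEdges : Set
  NoSelfEdges = ∀ e → ∀ x → ends e ≡ (x , x) → ⊥

  Connected : Set
  Connected = ∀ u w → ∃[ es ] Walk u w es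

  Acyclic : Set
  Acyclic = ∀ u es → Walk u u es → Unique es → es ≡ []

  IsReflexiveTree : Set
  IsReflexiveTree = NoSelfEdges × Connected × Acyclic

  Neighbour : Fin n → Fin n → Set
  Neighbour u v = ∃[ e ] Joins e u v

  -- Voltage assignment into ℤ_p and the lift T^σ.
  -- Arcs from x to y with their voltage (as an integer, to be read mod p):
  --   e⁺ : tail → head, voltage φe e;   e⁻ : head → tail, voltage -(φe e);
  --   loop at x: primary arc voltage φl x, secondary arc voltage -(φl x).
  Arc : Fin n → Fin n → ℤ → Set
  Arc x y s =
      (∃[ e ] (ends e ≡ (x , y) × s ≡ φe e))
    ⊎ (∃[ e ] (ends e ≡ (y , x) × s ≡ - φe e))
    ⊎ (x ≡ y × s ≡ φl x)
    ⊎ (x ≡ y × s ≡ - φl x)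

  -- adjacency in T^σ with vertex set Fin n × ℤ_p (ℤ_p represented by Fin p):
  -- (u,a) ~ (w,b) iff some arc (u,w) has σ(u,w) = b - a in ℤ_p.
  LiftAdj : (p : ℕ) → Fin n × Fin p → Fin n × Fin p → Set
  LiftAdj p (u , a) (w , b) =
    ∃[ s ] (Arc u w s × ((+ p) ∣ℤ ((+ toℕ b - + toℕ a) - s)))

Consecutive : {V : Set} → (V → V → Set) → List V → Set
Consecutive R []            = ⊤
Consecutive R (x ∷ [])      = ⊤
Consecutive R (x ∷ y ∷ xs)  = R x y × Consecutive R (y ∷ xs)

Hamiltonian : (V : Set) → (V → V → Set) → Set
Hamiltonian V Adj =
  Σ[ x ∈ V ] Σ[ rest ∈ List V ]
    ( Unique (x ∷ rest)
    × (∀ v → v ∈ (x ∷ rest))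
    × (3 ≤ length (x ∷ rest))
    × Consecutive Adj ((x ∷ rest) ++ [ x ]) )

{-# OPTIONS --safe #-}
module Submission where

-- Pick a neighbour u of v, so that the fibres of v and u are cycles with the
-- same step K, and a spanning forest rooted at {v , u}; potentials turn every
-- rung between a fibre and its parent fibre into a translation.
--
-- Each other vertex x deletes from its fibre, which has step k, the edges
-- {b , b + k} and {b + K , b + K + k} (only the first one if k = K).  The
-- loose ends {b , b + K , b + k , b + k + K} are carried upwards like a
-- billiard ball: at each vertex w on the way to the root, a rung from below
-- arrives at a + k w, the edge {a , a + k w} of the fibre of w is deleted, and
-- a rung leaves upwards from a.  At the root the loose ends are again the ends
-- of fibre edges, {b , b + K} and {b + k , b + k + K}, which are deleted.  The
-- result is a 2-regular spanning subgraph.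
--
-- Replacing the edges {i , i + K} of the fibres of v and u by the two rungs at
-- i and i + K merges two cycles whenever these edges lie on different ones.
-- Going once through all columns i where neither edge was deleted leaves a
-- single cycle: no two consecutive columns carry deleted edges, at most one
-- edge of a column is deleted, and every step generates ℤ_p as p is a large
-- prime.

open import Defs
open import Data.Bool using (Bool; true; false; _∨_; if_then_else_)
open import Data.Fin using (Fin; toℕ; fromℕ<; combine) renaming (zero to fzero; suc to fsuc)
open import Data.Fin.Properties using (any?; combine-injective; nonZeroIndex; pigeonhole; toℕ-fromℕ<; toℕ-injective; toℕ<n) renaming (_≟_ to _≟F_)
open import Data.Integer as ℤ using (ℤ; +_; +0; -_; _-_; ∣_∣; _%ℕ_; _/ℕ_)
open import Data.Integer.DivMod using (a≡a%ℕn+[a/ℕn]*n)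
open import Data.Integer.Properties using (neg-involutive; ∣-i∣≡∣i∣; abs-*; pos-+; pos-*; 0≤i⇒+∣i∣≡i; drop‿+<+) renaming (<⇒≤ to ℤ<⇒≤)
import Data.Integer.Solver as ℤSolver
open import Data.List using (List; []; _∷_; _++_; [_]; length; applyUpTo; allFin)
open import Data.List.Membership.Propositional using (_∈_)
open import Data.List.Membership.Propositional.Properties using (∈-allFin; ∈-applyUpTo⁺)
open import Data.List.Properties using (applyUpTo-∷ʳ)
open import Data.List.Relation.Unary.Any using (here; there)
open import Data.List.Relation.Unary.Unique.Propositional.Properties using (applyUpTo⁺₁)
open import Data.Nat using (ℕ; zero; suc; _+_; _*_; _∸_; _≤_; _<_; z≤n; s≤s; >-nonZero)
open import Data.Nat.Coprimality using (prime⇒coprime; coprime-Bézout) renaming (sym to coprime-sym)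
open import Data.Nat.DivMod using (_/_; _%_; _mod_; m%n<n; %-distribˡ-+; [m+kn]%n≡m%n; m<n⇒m%n≡m; m%n%n≡m%n; m≡m%n+[m/n]*n)
open import Data.Nat.Divisibility using (_∣_; divides)
open import Data.Nat.GCD using (module Bézout)
open import Data.Nat.Induction using (<-wellFounded)
open import Data.Nat.Primality using (Prime)
open import Data.Nat.Properties
import Data.Nat.Solver as ℕSolver
open import Data.Product using (_×_; _,_; ∃-syntax; proj₁; proj₂)
open import Data.Product.Properties using (≡-dec)
open import Data.Sum using (_⊎_; inj₁; inj₂)
open import Data.Unit using (tt)
open import Function using (_∘_)
open import Induction.WellFounded using (Acc; acc)
open import Relation.Binary.PropositionalEquality using (_≡_; _≢_; refl; sym; trans; cong; subst; subst₂; module ≡-Reasoning)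
open import Relation.Nullary using (¬_; Dec; yes; no; contradiction)
open import Relation.Nullary.Decidable using (map′; ¬?; _×-dec_; _⊎-dec_; does; dec-true; dec-false; decidable-stable)

-- Residues modulo p

module Residues (p′ : ℕ) where

  private
    p : ℕ
    p = suc p′

  infixl 6 _⊕_ _⊖_

  _⊕_ : Fin p → ℕ → Fin p
  a ⊕ k = (toℕ a + k) mod p

  toℕ-⊕ : ∀ a k → toℕ (a ⊕ k) ≡ (toℕ a + k) % p
  toℕ-⊕ a k = toℕ-fromℕ< (m%n<n (toℕ a + k) p)

  ⊕-≡ : ∀ a b i j → (toℕ a + i) % p ≡ (toℕ b + j) % p → a ⊕ i ≡ b ⊕ j
  ⊕-≡ a b i j eq = toℕ-injective (trans (toℕ-⊕ a i) (trans eq (sym (toℕ-⊕ b j))))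

  ⊕-⊕ : ∀ a i j → a ⊕ i ⊕ j ≡ a ⊕ (i + j)
  ⊕-⊕ a i j = ⊕-≡ (a ⊕ i) a j (i + j) (begin
    (toℕ (a ⊕ i) + j) % p                ≡⟨ cong (λ t → (t + j) % p) (toℕ-⊕ a i) ⟩
    ((toℕ a + i) % p + j) % p            ≡⟨ %-distribˡ-+ ((toℕ a + i) % p) j p ⟩
    ((toℕ a + i) % p % p + j % p) % p    ≡⟨ cong (λ t → (t + j % p) % p) (m%n%n≡m%n (toℕ a + i) p) ⟩
    ((toℕ a + i) % p + j % p) % p        ≡⟨ %-distribˡ-+ (toℕ a + i) j p ⟨
    (toℕ a + i + j) % p                  ≡⟨ cong (_% p) (+-assoc (toℕ a) i j) ⟩
    (toℕ a + (i + j)) % p                ∎)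
    where
    open ≡-Reasoning

  ⊕-comm : ∀ a i j → a ⊕ i ⊕ j ≡ a ⊕ j ⊕ i
  ⊕-comm a i j = trans (⊕-⊕ a i j) (trans (cong (a ⊕_) (+-comm i j)) (sym (⊕-⊕ a j i)))

  ⊕-< : ∀ a b i → toℕ a + i ≡ toℕ b → a ⊕ i ≡ b
  ⊕-< a b i eq = toℕ-injective
    (trans (toℕ-⊕ a i) (trans (cong (_% p) eq) (m<n⇒m%n≡m (toℕ<n b))))

  ⊕-multiple : ∀ a m → a ⊕ (m * p) ≡ a
  ⊕-multiple a m = toℕ-injective
    (trans (toℕ-⊕ a (m * p)) (trans ([m+kn]%n≡m%n (toℕ a) m p) (m<n⇒m%n≡m (toℕ<n a))))

  ⊕-0 : ∀ a → a ⊕ 0 ≡ a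
  ⊕-0 a = ⊕-multiple a 0

  -- Since `p′` is -1 modulo `p`, subtraction is again a translation by a natural number, so the
  -- laws of `_⊕_` apply to it.
  _⊖_ : Fin p → ℕ → Fin p
  a ⊖ k = a ⊕ k * p′

  ⊕-⊖ : ∀ a k → a ⊕ k ⊖ k ≡ a
  ⊕-⊖ a k = trans (⊕-⊕ a k (k * p′))
    (trans (cong (a ⊕_) (sym (*-suc k p′))) (⊕-multiple a k))

  ⊖-⊕ : ∀ a k → a ⊖ k ⊕ k ≡ a
  ⊖-⊕ a k = trans (⊕-⊕ a (k * p′) k)
    (trans (cong (a ⊕_) (trans (+-comm (k * p′) k) (sym (*-suc k p′)))) (⊕-multiple a k))

  ⊕-injective : ∀ {a b} k → a ⊕ k ≡ b ⊕ k → a ≡ b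
  ⊕-injective {a} {b} k eq = trans (sym (⊕-⊖ a k)) (trans (cong (_⊖ k) eq) (⊕-⊖ b k))

  module Generation (p-prime : Prime p) {k : ℕ} (0<k : 0 < k) (k<p : k < p) where

    module _ (P : Fin p → Set) (closed : ∀ a → P a → P (a ⊕ k)) where

      private
        closed-multiple : ∀ t a → P a → P (a ⊕ (t * k))
        closed-multiple zero    a h = subst P (sym (⊕-0 a)) h
        closed-multiple (suc t) a h =
          subst P (⊕-⊕ a k (t * k)) (closed-multiple t (a ⊕ k) (closed a h))

        -- Bézout coefficients invert `k` modulo the prime `p`, so steps of `k` compose to a step of
        -- 1.
        closed-1 : ∀ a → P a → P (a ⊕ 1)
        closed-1 a h with coprime-Bézout (coprime-sym (prime⇒coprime p-prime {{>-nonZero 0<k}} k<p))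
        ... | Bézout.+- x y eq = subst P (begin
            a ⊕ (x * k)      ≡⟨ cong (a ⊕_) eq ⟨
            a ⊕ (1 + y * p)  ≡⟨ ⊕-⊕ a 1 (y * p) ⟨
            a ⊕ 1 ⊕ (y * p)  ≡⟨ ⊕-multiple (a ⊕ 1) y ⟩
            a ⊕ 1            ∎) (closed-multiple x a h)
          where
          open ≡-Reasoning
        -- Here `x * k` is -1 modulo `p`, and the further factor `p′` corrects the sign.
        ... | Bézout.-+ x y eq = subst P (begin
            a ⊕ (p′ * x * k)                ≡⟨ ⊕-multiple (a ⊕ (p′ * x * k)) 1 ⟨
            a ⊕ (p′ * x * k) ⊕ (1 * p)      ≡⟨ ⊕-⊕ a _ _ ⟩
            a ⊕ (p′ * x * k + 1 * p)        ≡⟨ cong (a ⊕_) (solve 3 (λ q x k →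
                                                 q :* x :* k :+ con 1 :* (con 1 :+ q) :=
                                                 con 1 :+ q :* (con 1 :+ x :* k)) refl p′ x k) ⟩
            a ⊕ (1 + p′ * (1 + x * k))      ≡⟨ cong (λ t → a ⊕ (1 + p′ * t)) eq ⟩
            a ⊕ (1 + p′ * (y * p))          ≡⟨ cong (λ t → a ⊕ (1 + t)) (*-assoc p′ y p) ⟨
            a ⊕ (1 + p′ * y * p)            ≡⟨ ⊕-⊕ a 1 _ ⟨
            a ⊕ 1 ⊕ (p′ * y * p)            ≡⟨ ⊕-multiple (a ⊕ 1) (p′ * y) ⟩
            a ⊕ 1                           ∎) (closed-multiple (p′ * x) a h)
          where
          open ≡-Reasoning
          open ℕSolver.+-*-Solver

        closed-ℕ : ∀ t a → P a → P (a ⊕ t)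
        closed-ℕ zero    a h = subst P (sym (⊕-0 a)) h
        closed-ℕ (suc t) a h = subst P (⊕-⊕ a 1 t) (closed-ℕ t (a ⊕ 1) (closed-1 a h))

      ⊕-closed⇒all : ∀ {a} → P a → ∀ b → P b
      ⊕-closed⇒all {a} h b = subst P (trans (⊕-≡ a b t 0 (begin
          (toℕ a + (toℕ b + toℕ a * p′)) % p  ≡⟨ cong (_% p) (solve 3 (λ a b q →
                                                   a :+ (b :+ a :* q) :=
                                                   b :+ con 0 :+ a :* (con 1 :+ q)) refl (toℕ a) (toℕ b) p′) ⟩
          (toℕ b + 0 + toℕ a * p) % p         ≡⟨ [m+kn]%n≡m%n (toℕ b + 0) (toℕ a) p ⟩
          (toℕ b + 0) % p                     ∎)) (⊕-0 b)) (closed-ℕ t a h)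
        where
        open ≡-Reasoning
        open ℕSolver.+-*-Solver
        -- This represents `b` - `a` modulo `p`.
        t = toℕ b + toℕ a * p′

    -- Closure under backward steps is forward closure of the predicate `P c → P b` in `c`, which
    -- holds trivially at `b`.
    ⊖-closed⇒all : (P : Fin p → Set) → (∀ a → P (a ⊕ k) → P a) →
                   ∀ {a} → P a → ∀ b → P b
    ⊖-closed⇒all P closed {a} h b =
      ⊕-closed⇒all (λ c → P c → P b) (λ c Pc⇒Pb Pc⊕k → Pc⇒Pb (closed c Pc⊕k)) (λ Pb → Pb) a h

-- Two-regular graphs as matchings of darts

least : {P : ℕ → Set} → (∀ i → Dec (P i)) → ∀ m → P m →
        ∃[ l ] (P l × (∀ {i} → i < l → ¬ P i))
least P? zero    h = zero , h , λ ()
least P? (suc m) h with P? zero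
... | yes h₀ = zero , h₀ , λ ()
... | no ¬h₀ with least (P? ∘ suc) m h
...   | l , hₗ , minimal = suc l , hₗ , λ { {zero} _ → ¬h₀ ; {suc i} (s≤s i<l) → minimal i<l }

consecutive-applyUpTo : {V : Set} {R : V → V → Set} (f : ℕ → V) →
  (∀ i → R (f i) (f (suc i))) → ∀ m → Consecutive R (applyUpTo f m)
consecutive-applyUpTo f related zero          = tt
consecutive-applyUpTo f related (suc zero)    = tt
consecutive-applyUpTo f related (suc (suc m)) =
  related 0 , consecutive-applyUpTo (f ∘ suc) (related ∘ suc) (suc m)

three-members : {V : Set} {x y z : V} {xs : List V} → x ≢ y → y ≢ z → x ≢ z →
                x ∈ xs → y ∈ xs → z ∈ xs → 3 ≤ length xs
three-members {xs = _ ∷ _ ∷ _ ∷ _} x≢y y≢z x≢z _ _ _ = s≤s (s≤s (s≤s z≤n))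
three-members {xs = _ ∷ []} x≢y y≢z x≢z (here refl) (here refl) _ = contradiction refl x≢y
three-members {xs = _ ∷ _ ∷ []} x≢y y≢z x≢z (here refl) (here refl) _ = contradiction refl x≢y
three-members {xs = _ ∷ _ ∷ []} x≢y y≢z x≢z (here refl) (there (here refl)) (here refl) = contradiction refl x≢z
three-members {xs = _ ∷ _ ∷ []} x≢y y≢z x≢z (here refl) (there (here refl)) (there (here refl)) = contradiction refl y≢z
three-members {xs = _ ∷ _ ∷ []} x≢y y≢z x≢z (there (here refl)) (here refl) (here refl) = contradiction refl y≢z
three-members {xs = _ ∷ _ ∷ []} x≢y y≢z x≢z (there (here refl)) (here refl) (there (here refl)) = contradiction refl x≢z
three-members {xs = _ ∷ _ ∷ []} x≢y y≢z x≢z (there (here refl)) (there (here refl)) _ = contradiction refl x≢y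

-- Every vertex carries exactly two darts, exchanged by flip; a 2-regular
-- graph is a perfect matching of the darts.
module Darts {D V : Set} {N : ℕ}
  (index : D → Fin N) (index-injective : ∀ {d e} → index d ≡ index e → d ≡ e)
  (vert : D → V) (flip : D → D)
  (flip-flip : ∀ d → flip (flip d) ≡ d) (flip≢ : ∀ d → flip d ≢ d)
  (vert-flip : ∀ d → vert (flip d) ≡ vert d)
  (vert-≡ : ∀ d e → vert d ≡ vert e → e ≡ d ⊎ e ≡ flip d)
  where

  infix 4 _≟ᴰ_

  _≟ᴰ_ : (d e : D) → Dec (d ≡ e)
  d ≟ᴰ e = map′ index-injective (cong index) (index d ≟F index e)

  flip-injective : ∀ {d e} → flip d ≡ flip e → d ≡ e
  flip-injective {d} {e} eq = trans (sym (flip-flip d)) (trans (cong flip eq) (flip-flip e))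

  record Matching : Set where
    no-eta-equality
    field
      partner     : D → D
      involutive  : ∀ d → partner (partner d) ≡ d
      irreflexive : ∀ d → partner d ≢ d

    partner-injective : ∀ {d e} → partner d ≡ partner e → d ≡ e
    partner-injective {d} {e} eq =
      trans (sym (involutive d)) (trans (cong partner eq) (involutive e))

    -- One step along a cycle: cross the edge at `d`, then turn to the other dart of the vertex
    -- reached.
    next : D → D
    next d = flip (partner d)

    next-injective : ∀ {d e} → next d ≡ next e → d ≡ e
    next-injective = partner-injective ∘ flip-injective

    iter : ℕ → D → D
    iter zero    d = d
    iter (suc k) d = next (iter k d)

    iter-next : ∀ k d → iter k (next d) ≡ iter (suc k) d
    iter-next zero    d = refl
    iter-next (suc k) d = cong next (iter-next k d)

    iter-cancel : ∀ i k d → iter i d ≡ iter (i + k) d → d ≡ iter k d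
    iter-cancel zero    k d eq = eq
    iter-cancel (suc i) k d eq = iter-cancel i k d (next-injective eq)

    iter-cancel-< : ∀ {i j} d → i < j → iter i d ≡ iter j d → iter (suc (j ∸ suc i)) d ≡ d
    iter-cancel-< {i} {j} d i<j eq = sym (iter-cancel i _ d (trans eq (cong (λ t → iter t d)
      (sym (trans (+-suc i (j ∸ suc i)) (m+[n∸m]≡n i<j))))))

    abstract
      period : ∀ d → ∃[ m ] (iter (suc m) d ≡ d × (∀ {i} → i < m → iter (suc i) d ≢ d))
      period d with pigeonhole (n<1+n N) (λ i → index (iter (toℕ i) d))
      ... | i , j , i<j , eq = least (λ k → iter (suc k) d ≟ᴰ d) (toℕ j ∸ suc (toℕ i))
                                 (iter-cancel-< d i<j (index-injective eq))

    -- A walk returning to its start in the opposite direction could be shortened by one step at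
    -- each end, until a dart fixed by `flip` or by `partner` remained.
    iter≢flip : ∀ k d → iter k d ≢ flip d
    iter≢flip zero          d eq = flip≢ d (sym eq)
    iter≢flip (suc zero)    d eq = irreflexive d (flip-injective eq)
    iter≢flip (suc (suc k)) d eq = iter≢flip k (next d) (begin
        iter k (next d)         ≡⟨ iter-next k d ⟩
        iter (suc k) d          ≡⟨ involutive _ ⟨
        partner (partner _)     ≡⟨ cong partner (flip-injective eq) ⟩
        partner d               ≡⟨ flip-flip _ ⟨
        flip (next d)           ∎)
      where
      open ≡-Reasoning

    data Conn (d : D) : D → Set where
      stop        : Conn d d
      via-flip    : ∀ {e} → Conn d e → Conn d (flip e)
      via-partner : ∀ {e} → Conn d e → Conn d (partner e)

    conn-trans : ∀ {a b c} → Conn a b → Conn b c → Conn a c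
    conn-trans h stop            = h
    conn-trans h (via-flip g)    = via-flip (conn-trans h g)
    conn-trans h (via-partner g) = via-partner (conn-trans h g)

    conn-sym : ∀ {a b} → Conn a b → Conn b a
    conn-sym stop = stop
    conn-sym (via-flip {e} h) =
      conn-trans (subst (Conn (flip e)) (flip-flip e) (via-flip stop)) (conn-sym h)
    conn-sym (via-partner {e} h) =
      conn-trans (subst (Conn (partner e)) (involutive e) (via-partner stop)) (conn-sym h)

    conn-iter : ∀ k d → Conn d (iter k d)
    conn-iter zero    d = stop
    conn-iter (suc k) d = via-flip (via-partner (conn-iter k d))

    module Orbit (d : D) where

      m : ℕ
      m = proj₁ (period d)

      returns : iter (suc m) d ≡ d
      returns = proj₁ (proj₂ (period d))

      iter-distinct : ∀ {i j} → i < j → j < suc m → iter i d ≢ iter j d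
      iter-distinct {i} {j} i<j (s≤s j≤m) eq =
        proj₂ (proj₂ (period d)) (≤-trans (∸-monoʳ-< (s≤s z≤n) i<j) j≤m) (iter-cancel-< d i<j eq)

      OnOrbit : D → ℕ → Set
      OnOrbit e k = e ≡ iter k d ⊎ e ≡ flip (iter k d)

      -- The darts of an orbit and their flips are closed under both moves: `partner` takes the dart
      -- at time `k` to the flip of the dart at time `k + 1`, cyclically. This reduces `Conn` to a
      -- bounded search.
      on-orbit : ∀ {e} → Conn d e → ∃[ k ] (k < suc m × OnOrbit e k)
      on-orbit stop = 0 , s≤s z≤n , inj₁ refl
      on-orbit (via-flip h) with on-orbit h
      ... | k , k<m , inj₁ refl = k , k<m , inj₂ refl
      ... | k , k<m , inj₂ refl = k , k<m , inj₁ (flip-flip _)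
      on-orbit (via-partner h) with on-orbit h
      ... | k , s≤s k≤m , inj₁ refl with m≤n⇒m<n∨m≡n k≤m
      ...   | inj₁ k<m  = suc k , s≤s k<m , inj₂ (sym (flip-flip _))
      ...   | inj₂ refl = 0 , s≤s z≤n , inj₂ (trans (sym (flip-flip _)) (cong flip returns))
      on-orbit (via-partner h) | zero , _ , inj₂ refl =
        m , ≤-refl , inj₁ (trans (cong (partner ∘ flip) (sym returns))
                            (trans (cong partner (flip-flip _)) (involutive _)))
      on-orbit (via-partner h) | suc k , s≤s k<m , inj₂ refl =
        k , <-trans k<m (n<1+n m) , inj₁ (trans (cong partner (flip-flip _)) (involutive _))

      abstract
        conn? : ∀ e → Dec (Conn d e)
        conn? e = map′ from (on-orbit {e})
          (anyUpTo? (λ k → (e ≟ᴰ iter k d) ⊎-dec (e ≟ᴰ flip (iter k d))) (suc m))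
          where
          from : ∃[ k ] (k < suc m × OnOrbit e k) → Conn d e
          from (k , _ , inj₁ refl) = conn-iter k d
          from (k , _ , inj₂ refl) = via-flip (conn-iter k d)

      -- Two darts at one vertex are equal or flips of each other; minimality of the period excludes
      -- the first, `iter≢flip` the second.
      vert-distinct : ∀ {i j} → i < j → j < suc m → vert (iter i d) ≢ vert (iter j d)
      vert-distinct {i} {j} i<j j<m eq with vert-≡ (iter i d) (iter j d) eq
      ... | inj₁ same = iter-distinct i<j j<m (sym same)
      ... | inj₂ opposite = iter≢flip (j ∸ i) (iter i d) (begin
          iter (j ∸ i) (iter i d)  ≡⟨ iter-iter (j ∸ i) i ⟩
          iter (j ∸ i + i) d       ≡⟨ cong (λ t → iter t d) (m∸n+n≡m (<⇒≤ i<j)) ⟩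
          iter j d                 ≡⟨ opposite ⟩
          flip (iter i d)          ∎)
        where
        open ≡-Reasoning
        iter-iter : ∀ a b → iter a (iter b d) ≡ iter (a + b) d
        iter-iter zero    b = refl
        iter-iter (suc a) b = cong next (iter-iter a b)

    hamiltonian : {Adj : V → V → Set} → (∀ d → Adj (vert d) (vert (partner d))) →
                  (∀ v → ∃[ d ] (vert d ≡ v)) →
                  ∀ {x y z : V} → x ≢ y → y ≢ z → x ≢ z →
                  (d : D) → (∀ e → Conn d e) → Hamiltonian V Adj
    hamiltonian {Adj} adj surjective x≢y y≢z x≢z d connected =
      f 0 , applyUpTo (f ∘ suc) m ,
      applyUpTo⁺₁ f (suc m) vert-distinct ,
      covers ,
      three-members x≢y y≢z x≢z (covers _) (covers _) (covers _) ,
      subst (Consecutive Adj) closed (consecutive-applyUpTo f adjacent (suc (suc m)))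
      where
      open Orbit d

      f : ℕ → V
      f k = vert (iter k d)

      adjacent : ∀ i → Adj (f i) (f (suc i))
      adjacent i = subst (Adj (f i)) (sym (vert-flip _)) (adj (iter i d))

      closed : applyUpTo f (suc (suc m)) ≡ applyUpTo f (suc m) ++ [ f 0 ]
      closed = trans (sym (applyUpTo-∷ʳ f (suc m)))
        (cong (λ t → applyUpTo f (suc m) ++ [ t ]) (cong vert returns))

      covers : ∀ v → v ∈ applyUpTo f (suc m)
      covers v with surjective v
      ... | e , refl with on-orbit (connected e)
      ...   | k , k<m , inj₁ refl = ∈-applyUpTo⁺ f k<m
      ...   | k , k<m , inj₂ refl = subst (_∈ applyUpTo f (suc m)) (sym (vert-flip _)) (∈-applyUpTo⁺ f k<m)

  module _ (M M′ : Matching) where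
    private
      module M  = Matching M
      module M′ = Matching M′

    conn-mono : (∀ d → M′.Conn d (M.partner d)) → ∀ {d e} → M.Conn d e → M′.Conn d e
    conn-mono embed M.stop            = M′.stop
    conn-mono embed (M.via-flip h)    = M′.via-flip (conn-mono embed h)
    conn-mono embed (M.via-partner h) = M′.conn-trans (conn-mono embed h) (embed _)

    -- The cycle through a leads from flip a back to partner a without using
    -- the edge at a, and it avoids the edge at b.
    around : ∀ {a b} → ¬ M.Conn a b →
      (∀ d → d ≢ a → d ≢ M.partner a → d ≢ b → d ≢ M.partner b → M′.partner d ≡ M.partner d) →
      M′.Conn a (M.partner a)
    around {a} {b} a≁b agree =
      M′.conn-trans (M′.via-flip M′.stop) (subst (M′.Conn (flip a)) last (go m ≤-refl))
      where
      open M.Orbit (flip a)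

      last : M.iter m (flip a) ≡ M.partner a
      last = M.partner-injective (trans (flip-injective returns) (sym (M.involutive a)))

      to-a : ∀ k → M.Conn (M.iter k (flip a)) a
      to-a k = M.conn-trans (M.conn-sym (M.conn-iter k (flip a)))
                 (subst (M.Conn (flip a)) (flip-flip a) (M.via-flip M.stop))

      go : ∀ k → k ≤ m → M′.Conn (flip a) (M.iter k (flip a))
      go zero    _   = M′.stop
      go (suc k) k<m = subst (M′.Conn (flip a)) (cong flip same)
                         (M′.via-flip (M′.via-partner (go k (<⇒≤ k<m))))
        where
        e = M.iter k (flip a)
        same : M′.partner e ≡ M.partner e
        same = agree e
          (λ e≡a → M.iter≢flip k (flip a) (trans e≡a (sym (flip-flip a))))
          (λ e≡pa → iter-distinct k<m ≤-refl (trans e≡pa (sym last)))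
          (λ e≡b → a≁b (M.conn-sym (subst (λ t → M.Conn t a) e≡b (to-a k))))
          (λ e≡pb → a≁b (M.conn-trans (M.conn-sym (to-a k)) (subst (λ t → M.Conn t b) (sym e≡pb)
                      (subst (M.Conn (M.partner b)) (M.involutive b) (M.via-partner M.stop)))))

    -- The edges at `a` and `b` lie on different cycles, so after the removal of both, the rest of
    -- each cycle still joins the two ends of its edge. These detours replace the removed edges.
    switch-conn : ∀ {a b} → ¬ M.Conn a b →
      (∀ d → d ≢ a → d ≢ M.partner a → d ≢ b → d ≢ M.partner b → M′.partner d ≡ M.partner d) →
      ∀ {d e} → M.Conn d e → M′.Conn d e
    switch-conn {a} {b} a≁b agree = conn-mono embed
      where
      back : ∀ c → M′.Conn c (M.partner c) → M′.Conn (M.partner c) (M.partner (M.partner c))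
      back c h = subst (M′.Conn (M.partner c)) (sym (M.involutive c)) (M′.conn-sym h)

      at-a : M′.Conn a (M.partner a)
      at-a = around a≁b agree

      at-b : M′.Conn b (M.partner b)
      at-b = around (a≁b ∘ M.conn-sym) (λ d ≢b ≢pb ≢a ≢pa → agree d ≢a ≢pa ≢b ≢pb)

      embed : ∀ d → M′.Conn d (M.partner d)
      embed d with d ≟ᴰ a | d ≟ᴰ M.partner a | d ≟ᴰ b | d ≟ᴰ M.partner b
      ... | yes refl | _ | _ | _ = at-a
      ... | no _ | yes refl | _ | _ = back a at-a
      ... | no _ | no _ | yes refl | _ = at-b
      ... | no _ | no _ | no _ | yes refl = back b at-b
      ... | no ≢a | no ≢pa | no ≢b | no ≢pb =
        subst (M′.Conn d) (agree d ≢a ≢pa ≢b ≢pb) (M′.via-partner M′.stop)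

-- Rooted spanning forests

module Roots {n : ℕ} (v u : Fin n) where

  Root : Fin n → Set
  Root w = w ≡ v ⊎ w ≡ u

  root? : ∀ w → Dec (Root w)
  root? w = (w ≟F v) ⊎-dec (w ≟F u)

  -- The offset between the cut points of a vertex and the cut points its
  -- children hand over to it.
  shift : (Fin n → ℕ) → Fin n → ℕ
  shift k w with root? w
  ... | yes _ = 0
  ... | no  _ = k w

  shift-root : ∀ k {w} → Root w → shift k w ≡ 0
  shift-root k {w} r with root? w
  ... | yes _ = refl
  ... | no ¬r = contradiction r ¬r

  shift-inner : ∀ k {w} → ¬ Root w → shift k w ≡ k w
  shift-inner k {w} ¬r with root? w
  ... | yes r = contradiction r ¬r
  ... | no _  = refl

module Forest {n : ℕ} (v u : Fin n) (par : Fin n → Fin n) (rank : Fin n → ℕ)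
  (rank-par : ∀ {w} → ¬ Roots.Root v u w → rank (par w) < rank w) where

  open Roots v u

  data Ascent : Fin n → Set where
    top : ∀ {w} → Root w → Ascent w
    up  : ∀ {w} → ¬ Root w → Ascent (par w) → Ascent w

  ascent : ∀ w → Ascent w
  ascent w = go w (<-wellFounded (rank w))
    where
    go : ∀ w → Acc _<_ (rank w) → Ascent w
    go w (acc rec) with root? w
    ... | yes r = top r
    ... | no ¬r = up ¬r (go (par w) (rec (rank-par ¬r)))

  infix 4 _⊑_

  -- Says that `c` lies on the path from `x` up to its root. Steps are taken only from vertices that
  -- are not roots, so the path stops at the first root it meets.
  data _⊑_ (c : Fin n) : Fin n → Set where
    here  : c ⊑ c
    there : ∀ {x} → ¬ Root x → c ⊑ par x → c ⊑ x

  ⊑-rank : ∀ {c x} → c ⊑ x → rank c ≤ rank x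
  ⊑-rank here         = ≤-refl
  ⊑-rank (there ¬r h) = ≤-trans (⊑-rank h) (<⇒≤ (rank-par ¬r))

  Child : Fin n → Fin n → Set
  Child c w = ¬ Root c × par c ≡ w

  -- A descendant comes with the child through which its path enters `w`, since the matching must
  -- know along which rung the path arrives.
  Below : Fin n → Fin n → Set
  Below w x = ∃[ c ] (Child c w × c ⊑ x)

  child⋢ : ∀ {c w} → Child c w → ¬ c ⊑ w
  child⋢ (¬r , refl) h = <⇒≱ (rank-par ¬r) (⊑-rank h)

  below-irrefl : ∀ {w} → ¬ Below w w
  below-irrefl (c , child , h) = child⋢ child h

  ⊑-root : ∀ {c r} → Root r → c ⊑ r → Root c
  ⊑-root r here         = r
  ⊑-root r (there ¬r _) = contradiction r ¬r

  ⊑-below : ∀ {c x} → c ⊑ x → x ≡ c ⊎ Below c x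
  ⊑-below here = inj₁ refl
  ⊑-below {c} {x} (there ¬r h) with ⊑-below h
  ... | inj₁ eq                   = inj₂ (x , (¬r , eq) , here)
  ... | inj₂ (c′ , child , below) = inj₂ (c′ , child , there ¬r below)

  below-⊑ : ∀ {w x} → ¬ Root w → Below w x → w ⊑ x
  below-⊑ ¬w (c , (¬r , refl) , here)       = there ¬r here
  below-⊑ ¬w (c , child , there ¬r h)       = there ¬r (below-⊑ ¬w (c , child , h))

  below? : ∀ w x → Dec (Below w x)
  below? w x = go (ascent x)
    where
    go : ∀ {x} → Ascent x → Dec (Below w x)
    go (top r) = no λ { (c , (¬r , _) , h) → ¬r (⊑-root r h) }
    go {x} (up ¬r a) with par x ≟F w | go a
    ... | yes eq | _ = yes (x , (¬r , eq) , here)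
    ... | no _   | yes (c , child , h) = yes (c , child , there ¬r h)
    ... | no neq | no ¬b = no λ where
      (c , (_ , eq) , here)     → neq eq
      (c , child , there _ h)   → ¬b (c , child , h)

  -- Ranks fall strictly along a path, so no child of `w` occurs once the path has reached `w`.
  child-unique : ∀ {c c′ w x} → Child c w → c ⊑ x → Child c′ w → c′ ⊑ x → c ≡ c′
  child-unique _ here _ here = refl
  child-unique (_ , refl) here child′ (there _ h) = contradiction h (child⋢ child′)
  child-unique child (there _ h) (_ , refl) here = contradiction h (child⋢ child)
  child-unique child (there _ h) child′ (there _ h′) = child-unique child h child′ h′

  -- The subtrees of the two roots are disjoint. This is why a column loses its edge at one root at
  -- most.
  root-unique : ∀ {r r′ x} → Root r → Root r′ → Below r x → Below r′ x → r ≡ r′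
  root-unique root root′ (c , (_ , refl) , here) (c′ , (_ , refl) , here) = refl
  root-unique root root′ (c , (_ , refl) , here) (c′ , (¬r , _) , there _ h) =
    contradiction (⊑-root root h) ¬r
  root-unique root root′ (c , (¬r , _) , there _ h) (c′ , (_ , refl) , here) =
    contradiction (⊑-root root′ h) ¬r
  root-unique root root′ (c , child , there _ h) (c′ , child′ , there _ h′) =
    root-unique root root′ (c , child , h) (c′ , child′ , h′)

  module Potential (base : Fin n → ℕ) (gain : Fin n → ℕ) where

    private
      along : ∀ {w} → Ascent w → ℕ
      along (top {w} _)  = base w
      along (up {w} _ a) = along a + gain w

      -- The ascent of `w` comes from well-founded recursion; independence of its choice gives the
      -- recursion equations of the potential.
      along-irrelevant : ∀ {w} (a b : Ascent w) → along a ≡ along b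
      along-irrelevant (top _)  (top _)  = refl
      along-irrelevant (top r)  (up ¬r _) = contradiction r ¬r
      along-irrelevant (up ¬r _) (top r)  = contradiction r ¬r
      along-irrelevant (up {w} _ a) (up _ b) = cong (_+ gain w) (along-irrelevant a b)

    potential : Fin n → ℕ
    potential w = along (ascent w)

    potential-root : ∀ {w} → Root w → potential w ≡ base w
    potential-root {w} r = along-irrelevant (ascent w) (top r)

    potential-par : ∀ {w} → ¬ Root w → potential w ≡ potential (par w) + gain w
    potential-par {w} ¬r = along-irrelevant (ascent w) (up ¬r (ascent (par w)))

module Spanning {n m : ℕ} (G : ReflexiveGraph n m) (connected : Connected G) (v u : Fin n) where

  open ReflexiveGraph G
  open Roots v u

  private
    joins? : ∀ e x y → Dec (Joins G e x y)
    joins? e x y = (≡-dec _≟F_ _≟F_ (ends e) (x , y)) ⊎-dec (≡-dec _≟F_ _≟F_ (ends e) (y , x))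

    -- Walks of exactly `k` steps to a root; the least such `k` is the distance to the roots and
    -- serves as the rank.
    Reach : ℕ → Fin n → Set
    Reach zero    w = Root w
    Reach (suc k) w = ∃[ y ] (Neighbour G w y × Reach k y)

    reach? : ∀ k w → Dec (Reach k w)
    reach? zero    w = root? w
    reach? (suc k) w = any? (λ y → any? (λ e → joins? e w y) ×-dec reach? k y)

    walk-reach : ∀ {w es} → Walk G w v es → ∃[ k ] Reach k w
    walk-reach nil = zero , inj₁ refl
    walk-reach (step e j walk) with walk-reach walk
    ... | k , r = suc k , _ , (e , j) , r

    nearest : ∀ w → ∃[ k ] (Reach k w × (∀ {i} → i < k → ¬ Reach i w))
    nearest w with walk-reach (proj₂ (connected w v))
    ... | k , r = least (λ i → reach? i w) k r

  rank : Fin n → ℕ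
  rank w = proj₁ (nearest w)

  private
    parent : ∀ w → Root w ⊎ ∃[ y ] (Neighbour G w y × rank y < rank w)
    parent w with nearest w
    ... | zero  , r , _ = inj₁ r
    ... | suc k , (y , adj , r) , _ = inj₂ (y , adj , s≤s (≮⇒≥ λ k<l → proj₂ (proj₂ (nearest y)) k<l r))
      where
      open Data.Nat using (s≤s)

  par : Fin n → Fin n
  par w with parent w
  -- A root gets itself as a default value.
  ... | inj₁ _       = w
  ... | inj₂ (y , _) = y

  rank-par : ∀ {w} → ¬ Root w → rank (par w) < rank w
  rank-par {w} ¬r with parent w
  ... | inj₁ r            = contradiction r ¬r
  ... | inj₂ (_ , _ , lt) = lt

  par-adjacent : ∀ {w} → ¬ Root w → Neighbour G w (par w)
  par-adjacent {w} ¬r with parent w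
  ... | inj₁ r           = contradiction r ¬r
  ... | inj₂ (_ , j , _) = j

-- Positions of the cuts

data Phase : Set where
  start end : Phase

data Level : Set where
  lower upper : Level

-- Own a x φ ℓ: a is one of the points at which the fibre of x is cut.  The
-- point is the start or the end of a deleted edge of step k x in the fibre
-- of x, and the lower or the upper end of a deleted edge of step K in the
-- fibre of a root.
record Layout {n : ℕ} (p′ : ℕ) (Root : Fin n → Set) (k : Fin n → ℕ) (K : ℕ) : Set₁ where
  open Residues p′
  field
    Own         : Fin (suc p′) → Fin n → Phase → Level → Set
    own?        : ∀ a → Dec (∃[ x ] ∃[ φ ] ∃[ ℓ ] Own a x φ ℓ)
    own-unique  : ∀ {a x y φ ψ ℓ ℓ′} → Own a x φ ℓ → Own a y ψ ℓ′ → x ≡ y × φ ≡ ψ × ℓ ≡ ℓ′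
    own-inner   : ∀ {a x φ ℓ} → Own a x φ ℓ → ¬ Root x
    start⇒end   : ∀ {a x ℓ} → Own a x start ℓ → ∃[ ℓ′ ] Own (a ⊕ k x) x end ℓ′
    end⇒start   : ∀ {a x ℓ} → Own a x end ℓ → ∃[ ℓ′ ] Own (a ⊖ k x) x start ℓ′
    lower⇒upper : ∀ {a x φ} → Own a x φ lower → ∃[ ψ ] Own (a ⊕ K) x ψ upper
    upper⇒lower : ∀ {a x φ} → Own a x φ upper → ∃[ ψ ] Own (a ⊖ K) x ψ lower
    own-start   : ∀ {x} → ¬ Root x → ∃[ a ] Own a x start lower

-- Offsets of the cut points of x inside its block; the two families of
-- deleted edges coincide when k ≡ K.
data Corner (k K : ℕ) : Phase → Level → ℕ → Set where
  c₀₀ : Corner k K start lower 0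
  c₀₁ : k ≢ K → Corner k K start upper K
  c₁₀ : k ≢ K → Corner k K end lower k
  c₁₁ : k ≢ K → Corner k K end upper (k + K)
  c=  : k ≡ K → Corner k K end upper K

corner? : ∀ k K o → Dec (∃[ φ ] ∃[ ℓ ] Corner k K φ ℓ o)
corner? k K o with k ≟ K | o ≟ 0 | o ≟ K | o ≟ k | o ≟ k + K
... | _      | yes refl | _ | _ | _ = yes (_ , _ , c₀₀)
... | yes eq | no _ | yes refl | _ | _ = yes (_ , _ , c= eq)
... | yes eq | no o≢0 | no o≢K | _ | _ = no λ where
  (_ , _ , c₀₀)    → o≢0 refl
  (_ , _ , c₀₁ ne) → ne eq
  (_ , _ , c₁₀ ne) → ne eq
  (_ , _ , c₁₁ ne) → ne eq
  (_ , _ , c= _)   → o≢K refl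
... | no ne  | no _ | yes refl | _ | _ = yes (_ , _ , c₀₁ ne)
... | no ne  | no _ | no _ | yes refl | _ = yes (_ , _ , c₁₀ ne)
... | no ne  | no _ | no _ | no _ | yes refl = yes (_ , _ , c₁₁ ne)
... | no ne  | no o≢0 | no o≢K | no o≢k | no o≢k+K = no λ where
  (_ , _ , c₀₀)   → o≢0 refl
  (_ , _ , c₀₁ _) → o≢K refl
  (_ , _ , c₁₀ _) → o≢k refl
  (_ , _ , c₁₁ _) → o≢k+K refl
  (_ , _ , c= eq) → ne eq

corner-≤ : ∀ {k K φ ℓ o} → Corner k K φ ℓ o → o ≤ k + K
corner-≤ c₀₀             = z≤n
corner-≤ {k} {K} (c₀₁ _) = m≤n+m K k
corner-≤ {k} {K} (c₁₀ _) = m≤m+n k K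
corner-≤ (c₁₁ _)         = ≤-refl
corner-≤ {k} {K} (c= _)  = m≤n+m K k

-- For positive `k ≢ K` the offsets 0, `K`, `k` and `k + K` are distinct; for `k ≡ K` only 0 and `K`
-- occur.
corner-unique : ∀ {k K φ ψ ℓ ℓ′ o o′} → 0 < k → 0 < K →
  Corner k K φ ℓ o → Corner k K ψ ℓ′ o′ → o ≡ o′ → φ ≡ ψ × ℓ ≡ ℓ′
corner-unique 0<k 0<K c₀₀      c₀₀      eq = refl , refl
corner-unique 0<k 0<K c₀₀      (c₀₁ _)  eq = contradiction eq (<⇒≢ 0<K)
corner-unique 0<k 0<K c₀₀      (c₁₀ _)  eq = contradiction eq (<⇒≢ 0<k)
corner-unique 0<k 0<K c₀₀      (c₁₁ _)  eq = contradiction eq (<⇒≢ (≤-trans 0<k (m≤m+n _ _)))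
corner-unique 0<k 0<K c₀₀      (c= _)   eq = contradiction eq (<⇒≢ 0<K)
corner-unique 0<k 0<K (c₀₁ _)  (c₀₁ _)  eq = refl , refl
corner-unique 0<k 0<K (c₀₁ ne) (c₁₀ _)  eq = contradiction (sym eq) ne
corner-unique 0<k 0<K (c₀₁ _)  (c₁₁ _)  eq = contradiction eq (<⇒≢ (m<n+m _ 0<k))
corner-unique 0<k 0<K (c₀₁ ne) (c= e)   eq = contradiction e ne
corner-unique 0<k 0<K (c₁₀ _)  (c₁₀ _)  eq = refl , refl
corner-unique 0<k 0<K (c₁₀ _)  (c₁₁ _)  eq = contradiction eq (<⇒≢ (m<m+n _ 0<K))
corner-unique 0<k 0<K (c₁₀ ne) (c= e)   eq = contradiction e ne
corner-unique 0<k 0<K (c₁₁ _)  (c₁₁ _)  eq = refl , refl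
corner-unique 0<k 0<K (c₁₁ ne) (c= e)   eq = contradiction e ne
corner-unique 0<k 0<K (c= _)   (c= _)   eq = refl , refl
corner-unique 0<k 0<K (c₀₁ _)  c₀₀      eq = contradiction (sym eq) (<⇒≢ 0<K)
corner-unique 0<k 0<K (c₁₀ _)  c₀₀      eq = contradiction (sym eq) (<⇒≢ 0<k)
corner-unique 0<k 0<K (c₁₀ ne) (c₀₁ _)  eq = contradiction eq ne
corner-unique 0<k 0<K (c₁₁ _)  c₀₀      eq = contradiction (sym eq) (<⇒≢ (≤-trans 0<k (m≤m+n _ _)))
corner-unique 0<k 0<K (c₁₁ _)  (c₀₁ _)  eq = contradiction (sym eq) (<⇒≢ (m<n+m _ 0<k))
corner-unique 0<k 0<K (c₁₁ _)  (c₁₀ _)  eq = contradiction (sym eq) (<⇒≢ (m<m+n _ 0<K))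
corner-unique 0<k 0<K (c= _)   c₀₀      eq = contradiction (sym eq) (<⇒≢ 0<K)
corner-unique 0<k 0<K (c= e)   (c₀₁ ne) eq = contradiction e ne
corner-unique 0<k 0<K (c= e)   (c₁₀ ne) eq = contradiction e ne
corner-unique 0<k 0<K (c= e)   (c₁₁ ne) eq = contradiction e ne

block-unique : ∀ M′ x y o o′ → o < suc M′ → o′ < suc M′ →
  x * suc M′ + o ≡ y * suc M′ + o′ → x ≡ y × o ≡ o′
block-unique M′ x y o o′ o<M o′<M eq =
  *-cancelʳ-≡ x y M (+-cancelʳ-≡ o _ _ (trans eq (cong (λ t → y * M + t) (sym o≡o′)))) , o≡o′
  where
  M = suc M′
  remainder : ∀ x o → o < M → (x * M + o) % M ≡ o
  remainder x o o<M = trans (cong (_% M) (+-comm (x * M) o))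
    (trans ([m+kn]%n≡m%n o x M) (m<n⇒m%n≡m o<M))
  o≡o′ : o ≡ o′
  o≡o′ = trans (sym (remainder x o o<M)) (trans (cong (_% M) eq) (remainder y o′ o′<M))

-- Each `x` gets the interval of `suc B` residues starting at `toℕ x * suc B`. Its corners fit
-- inside, and all intervals fit below `p`, so no cut point wraps around and no two vertices share
-- one.
module Blocks {n : ℕ} (p′ : ℕ) {Root : Fin n → Set} (root? : ∀ w → Dec (Root w))
  (k : Fin n → ℕ) (K : ℕ) (0<k : ∀ w → 0 < k w) (0<K : 0 < K)
  (B : ℕ) (k+K≤B : ∀ w → k w + K ≤ B) (fits : n * suc B ≤ suc p′) where

  open Residues p′

  private
    M : ℕ
    M = suc B

    At : Fin (suc p′) → Fin n → ℕ → Set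
    At a x o = toℕ a ≡ toℕ x * M + o

    Own : Fin (suc p′) → Fin n → Phase → Level → Set
    Own a x φ ℓ = ¬ Root x × ∃[ o ] (Corner (k x) K φ ℓ o × At a x o)

    corner-< : ∀ {x φ ℓ o} → Corner (k x) K φ ℓ o → o < M
    corner-< {x} c = s≤s (≤-trans (corner-≤ c) (k+K≤B x))

    position : ∀ x {φ ℓ o} → Corner (k x) K φ ℓ o → ∃[ a ] At a x o
    position x {o = o} c = fromℕ< bound , toℕ-fromℕ< bound
      where
      bound : toℕ x * M + o < suc p′
      bound = ≤-trans (+-monoʳ-< (toℕ x * M) (corner-< {x} c))
        (≤-trans (≤-reflexive (+-comm (toℕ x * M) M)) (≤-trans (*-monoˡ-≤ M (toℕ<n x)) fits))

    own?-at : ∀ a x → Dec (∃[ φ ] ∃[ ℓ ] Own a x φ ℓ)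
    own?-at a x = map′ to from (¬? (root? x) ×-dec (corner? (k x) K r ×-dec (toℕ a ≟ toℕ x * M + r)))
      where
      -- The subtraction is truncated; the test `At a x r` discards points before the block.
      r = toℕ a ∸ toℕ x * M
      to : ¬ Root x × (∃[ φ ] ∃[ ℓ ] Corner (k x) K φ ℓ r) × At a x r → ∃[ φ ] ∃[ ℓ ] Own a x φ ℓ
      to (¬r , (φ , ℓ , c) , at) = φ , ℓ , ¬r , _ , c , at
      from : ∃[ φ ] ∃[ ℓ ] Own a x φ ℓ → ¬ Root x × (∃[ φ ] ∃[ ℓ ] Corner (k x) K φ ℓ r) × At a x r
      from (φ , ℓ , ¬r , o , c , at) = ¬r , (φ , ℓ , subst (Corner (k x) K φ ℓ) o≡r c) , subst (At a x) o≡r at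
        where
        o≡r : o ≡ r
        o≡r = sym (trans (cong (_∸ toℕ x * M) at) (m+n∸m≡n (toℕ x * M) o))

    own-unique : ∀ {a x y φ ψ ℓ ℓ′} → Own a x φ ℓ → Own a y ψ ℓ′ → x ≡ y × φ ≡ ψ × ℓ ≡ ℓ′
    own-unique {x = x} {y} (_ , o , c , at) (_ , o′ , c′ , at′)
      with block-unique B (toℕ x) (toℕ y) o o′ (corner-< {x} c) (corner-< {y} c′) (trans (sym at) at′)
    ... | x≡y , o≡o′ with toℕ-injective x≡y
    ...   | refl = refl , corner-unique (0<k x) 0<K c c′ o≡o′

    forward : ∀ {a x o i φ ℓ} → At a x o → Corner (k x) K φ ℓ (o + i) → At (a ⊕ i) x (o + i)
    forward {a} {x} {o} {i} at c with position x c
    ... | b , at′ = subst (λ t → At t x (o + i)) (sym (⊕-< a b i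
      (trans (cong (_+ i) at) (trans (+-assoc (toℕ x * M) o i) (sym at′))))) at′

    backward : ∀ {a} x {o} i {φ ℓ} → At a x (o + i) → Corner (k x) K φ ℓ o → At (a ⊖ i) x o
    backward {a} x {o} i at c with position x c
    ... | b , at′ = subst (λ t → At t x o) (sym (trans (cong (_⊖ i) (sym (⊕-< b a i
      (trans (cong (_+ i) at′) (trans (+-assoc (toℕ x * M) o i) (sym at)))))) (⊕-⊖ b i))) at′

  layout : Layout p′ Root k K
  layout = record
    { Own = Own
    ; own? = λ a → any? (own?-at a)
    ; own-unique = own-unique
    ; own-inner = proj₁
    ; start⇒end = start⇒end
    ; end⇒start = end⇒start
    ; lower⇒upper = lower⇒upper
    ; upper⇒lower = upper⇒lower
    ; own-start = λ {x} ¬r → let a , at = position x c₀₀ in a , ¬r , 0 , c₀₀ , at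
    }
    where
    start⇒end : ∀ {a x ℓ} → Own a x start ℓ → ∃[ ℓ′ ] Own (a ⊕ k x) x end ℓ′
    start⇒end {a} {x} (¬r , _ , c₀₀ , at) with k x ≟ K
    ... | no ne  = lower , ¬r , _ , c₁₀ ne , forward {a} at (c₁₀ ne)
    -- The single deleted edge is a step of `k x` and of `K` at once, so its end is also its upper
    -- point.
    ... | yes eq = upper , ¬r , _ , end-corner , forward {a} at end-corner
      where
      end-corner : Corner (k x) K end upper (k x)
      end-corner = subst (Corner (k x) K end upper) (sym eq) (c= eq)
    start⇒end {a} {x} (¬r , _ , c₀₁ ne , at) = upper , ¬r , _ , corner , forward {a} at corner
      where
      corner : Corner (k x) K end upper (K + k x)
      corner = subst (Corner (k x) K end upper) (+-comm (k x) K) (c₁₁ ne)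

    end⇒start : ∀ {a x ℓ} → Own a x end ℓ → ∃[ ℓ′ ] Own (a ⊖ k x) x start ℓ′
    end⇒start {a} {x} (¬r , _ , c₁₀ ne , at) = lower , ¬r , _ , c₀₀ , backward x (k x) at c₀₀
    end⇒start {a} {x} (¬r , _ , c₁₁ ne , at) =
      upper , ¬r , _ , c₀₁ ne , backward x (k x) (subst (At a x) (+-comm (k x) K) at) (c₀₁ ne)
    end⇒start {a} {x} (¬r , _ , c= eq , at) =
      lower , ¬r , _ , c₀₀ , backward x (k x) (subst (At a x) (sym eq) at) c₀₀

    lower⇒upper : ∀ {a x φ} → Own a x φ lower → ∃[ ψ ] Own (a ⊕ K) x ψ upper
    lower⇒upper {a} {x} (¬r , _ , c₀₀ , at) with k x ≟ K
    ... | no ne  = start , ¬r , _ , c₀₁ ne , forward {a} at (c₀₁ ne)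
    ... | yes eq = end , ¬r , _ , c= eq , forward {a} at (c= eq)
    lower⇒upper {a} {x} (¬r , _ , c₁₀ ne , at) = end , ¬r , _ , c₁₁ ne , forward {a} at (c₁₁ ne)

    upper⇒lower : ∀ {a x φ} → Own a x φ upper → ∃[ ψ ] Own (a ⊖ K) x ψ lower
    upper⇒lower {a} {x} (¬r , _ , c₀₁ ne , at) = start , ¬r , _ , c₀₀ , backward x K at c₀₀
    upper⇒lower {a} {x} (¬r , _ , c₁₁ ne , at) = end , ¬r , _ , c₁₀ ne , backward x K at (c₁₀ ne)
    upper⇒lower {a} {x} (¬r , _ , c= eq , at) = start , ¬r , _ , c₀₀ , backward x K at c₀₀

-- The billiard 2-factor

data End : Set where
  lo hi : End

opposite : End → End
opposite lo = hi
opposite hi = lo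

opposite-involutive : ∀ e → opposite (opposite e) ≡ e
opposite-involutive lo = refl
opposite-involutive hi = refl

-- A dart is an end of a fibre edge: (w , ζ , lo) and (w , ζ , hi) are the two
-- ends of the edge from ζ to ζ ⊕ k w in the fibre of w.
module FibreDarts {n : ℕ} (p′ : ℕ) (k h : Fin n → ℕ) where

  open Residues p′

  Dart : Set
  Dart = Fin n × Fin (suc p′) × End

  private
    end-index : End → Fin 2
    end-index lo = fzero
    end-index hi = fsuc fzero

    end-index-injective : ∀ {e f} → end-index e ≡ end-index f → e ≡ f
    end-index-injective {lo} {lo} _ = refl
    end-index-injective {hi} {hi} _ = refl

  index : Dart → Fin (n * (suc p′ * 2))
  index (w , ζ , e) = combine w (combine ζ (end-index e))

  index-injective : ∀ {d e} → index d ≡ index e → d ≡ e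
  index-injective {w , ζ , e} {x , ξ , f} eq with combine-injective w _ x _ eq
  ... | refl , eq′ with combine-injective ζ _ ξ _ eq′
  ...   | refl , eq″ with end-index-injective eq″
  ...     | refl = refl

  -- Positions are relative to the potential `h`, so that one label `a` names a cut point in every
  -- fibre that its path crosses.
  vert : Dart → Fin n × Fin (suc p′)
  vert (w , ζ , lo) = w , ζ ⊕ h w
  vert (w , ζ , hi) = w , ζ ⊕ k w ⊕ h w

  flip : Dart → Dart
  flip (w , ζ , lo) = w , ζ ⊖ k w , hi
  flip (w , ζ , hi) = w , ζ ⊕ k w , lo

  flip-flip : ∀ d → flip (flip d) ≡ d
  flip-flip (w , ζ , lo) = cong (λ t → w , t , lo) (⊖-⊕ ζ (k w))
  flip-flip (w , ζ , hi) = cong (λ t → w , t , hi) (⊕-⊖ ζ (k w))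

  flip≢ : ∀ d → flip d ≢ d
  flip≢ (w , ζ , lo) ()
  flip≢ (w , ζ , hi) ()

  vert-flip : ∀ d → vert (flip d) ≡ vert d
  vert-flip (w , ζ , lo) = cong (λ t → w , t ⊕ h w) (⊖-⊕ ζ (k w))
  vert-flip (w , ζ , hi) = refl

  private
    same-fibre : ∀ {w x : Fin n} {a b : Fin (suc p′)} → (w , a) ≡ (x , b) → w ≡ x × a ≡ b
    same-fibre refl = refl , refl

  vert-≡ : ∀ d e → vert d ≡ vert e → e ≡ d ⊎ e ≡ flip d
  vert-≡ (w , ζ , lo) (x , ξ , lo) eq with same-fibre eq
  ... | refl , eq′ = inj₁ (cong (λ t → w , t , lo) (sym (⊕-injective (h w) eq′)))
  vert-≡ (w , ζ , lo) (x , ξ , hi) eq with same-fibre eq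
  ... | refl , eq′ = inj₂ (cong (λ t → w , t , hi)
    (trans (sym (⊕-⊖ ξ (k w))) (cong (_⊖ k w) {ξ ⊕ k w} {ζ} (sym (⊕-injective (h w) eq′)))))
  vert-≡ (w , ζ , hi) (x , ξ , lo) eq with same-fibre eq
  ... | refl , eq′ = inj₂ (cong (λ t → w , t , lo) (sym (⊕-injective (h w) eq′)))
  vert-≡ (w , ζ , hi) (x , ξ , hi) eq with same-fibre eq
  ... | refl , eq′ = inj₁ (cong (λ t → w , t , hi) (sym (⊕-injective (k w) (⊕-injective (h w) eq′))))

  vert-surjective : ∀ x → ∃[ d ] (vert d ≡ x)
  vert-surjective (w , a) = (w , a ⊖ h w , lo) , cong (w ,_) (⊖-⊕ a (h w))

  open Darts index index-injective vert flip flip-flip flip≢ vert-flip vert-≡ public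

module Billiard {n : ℕ} (p′ : ℕ) (v u : Fin n) (v≢u : v ≢ u)
  (par : Fin n → Fin n) (rank : Fin n → ℕ)
  (rank-par : ∀ {w} → ¬ Roots.Root v u w → rank (par w) < rank w)
  (k : Fin n → ℕ) (K : ℕ) (k-root : ∀ {w} → Roots.Root v u w → k w ≡ K)
  (L : Layout p′ (Roots.Root v u) k K) (h : Fin n → ℕ) where

  open Residues p′
  open Roots v u
  open Forest v u par rank rank-par
  open Layout L
  open FibreDarts p′ k h

  private
    p : ℕ
    p = suc p′

  other : Fin n → Fin n
  other w with w ≟F v
  ... | yes _ = u
  ... | no  _ = v

  other-v : other v ≡ u
  other-v with v ≟F v
  ... | yes _ = refl
  ... | no ne = contradiction refl ne

  other-u : other u ≡ v
  other-u with u ≟F v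
  ... | yes eq = contradiction (sym eq) v≢u
  ... | no _   = refl

  other-root : ∀ {w} → Root w → Root (other w)
  other-root (inj₁ refl) = inj₂ other-v
  other-root (inj₂ refl) = inj₁ other-u

  other-involutive : ∀ {w} → Root w → other (other w) ≡ w
  other-involutive (inj₁ refl) = trans (cong other other-v) other-u
  other-involutive (inj₂ refl) = trans (cong other other-u) other-v

  other≢ : ∀ {w} → Root w → other w ≢ w
  other≢ (inj₁ refl) eq = v≢u (trans (sym eq) other-v)
  other≢ (inj₂ refl) eq = v≢u (trans (sym other-u) eq)

  -- The two darts matched along the rung from (c , a) to the parent fibre; a
  -- junk value unless a is a cut point.
  above : Fin n → Fin p → Dart
  above c a with root? (par c) | own? a
  ... | no _  | _                          = par c , a , hi
  ... | yes _ | no _                       = par c , a , lo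
  ... | yes _ | yes (_ , _ , lower , _)    = par c , a , lo
  ... | yes _ | yes (_ , _ , upper , _)    = par c , a ⊖ k (par c) , hi

  beneath : Fin n → Fin p → Dart
  beneath c a with own? a
  ... | no _ = c , a , lo
  ... | yes (x , start , _) = c , a , lo
  ... | yes (x , end , _) with x ≟F c
  ...   | yes _ = c , a ⊖ k c , hi
  ...   | no _  = c , a , lo

  above-fibre : ∀ c a → proj₁ (above c a) ≡ par c
  above-fibre c a with root? (par c) | own? a
  ... | no _  | _                       = refl
  ... | yes _ | no _                    = refl
  ... | yes _ | yes (_ , _ , lower , _) = refl
  ... | yes _ | yes (_ , _ , upper , _) = refl

  above-inner : ∀ {c} a → ¬ Root (par c) → above c a ≡ (par c , a , hi)
  above-inner {c} a ¬r with root? (par c) | own? a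
  ... | no _  | _ = refl
  ... | yes r | _ = contradiction r ¬r

  above-lower : ∀ {c a x φ} → Root (par c) → Own a x φ lower → above c a ≡ (par c , a , lo)
  above-lower {c} {a} r o with root? (par c) | own? a
  ... | no ¬r | _ = contradiction r ¬r
  ... | yes _ | no ¬o = contradiction (_ , _ , _ , o) ¬o
  ... | yes _ | yes (_ , _ , lower , _) = refl
  ... | yes _ | yes (_ , _ , upper , o′) with () ← proj₂ (proj₂ (own-unique o o′))

  above-upper : ∀ {c a x φ} → Root (par c) → Own a x φ upper →
                above c a ≡ (par c , a ⊖ k (par c) , hi)
  above-upper {c} {a} r o with root? (par c) | own? a
  ... | no ¬r | _ = contradiction r ¬r
  ... | yes _ | no ¬o = contradiction (_ , _ , _ , o) ¬o
  ... | yes _ | yes (_ , _ , upper , _) = refl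
  ... | yes _ | yes (_ , _ , lower , o′) with () ← proj₂ (proj₂ (own-unique o o′))

  beneath-fibre : ∀ c a → proj₁ (beneath c a) ≡ c
  beneath-fibre c a with own? a
  ... | no _ = refl
  ... | yes (x , start , _) = refl
  ... | yes (x , end , _) with x ≟F c
  ...   | yes _ = refl
  ...   | no _  = refl

  beneath-start : ∀ {c a x ℓ} → Own a x start ℓ → beneath c a ≡ (c , a , lo)
  beneath-start {c} {a} o with own? a
  ... | no _ = refl
  ... | yes (x , start , _) = refl
  ... | yes (x , end , _ , o′) with () ← proj₁ (proj₂ (own-unique o o′))

  beneath-other : ∀ {c a x φ ℓ} → Own a x φ ℓ → x ≢ c → beneath c a ≡ (c , a , lo)
  beneath-other {c} {a} o x≢c with own? a
  ... | no _ = refl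
  ... | yes (x , start , _) = refl
  ... | yes (x , end , _ , o′) with x ≟F c
  ...   | yes refl = contradiction (proj₁ (own-unique o o′)) x≢c
  ...   | no _     = refl

  beneath-end : ∀ {c a ℓ} → Own a c end ℓ → beneath c a ≡ (c , a ⊖ k c , hi)
  beneath-end {c} {a} o with own? a
  ... | no ¬o = contradiction (_ , _ , _ , o) ¬o
  ... | yes (x , start , _ , o′) with () ← proj₁ (proj₂ (own-unique o o′))
  ... | yes (x , end , _ , o′) with x ≟F c
  ...   | yes _  = refl
  ...   | no x≢c = contradiction (sym (proj₁ (own-unique o o′))) x≢c

  vert-above : ∀ {c a x φ ℓ} → Own a x φ ℓ →
               vert (above c a) ≡ (par c , a ⊕ shift k (par c) ⊕ h (par c))
  vert-above {c} {a} o = by (root? (par c)) o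
    where
    by : ∀ {x φ ℓ} → Dec (Root (par c)) → Own a x φ ℓ →
         vert (above c a) ≡ (par c , a ⊕ shift k (par c) ⊕ h (par c))
    by (no ¬r) o = trans (cong vert (above-inner {c} a ¬r))
      (cong (λ t → par c , a ⊕ t ⊕ h (par c)) (sym (shift-inner k ¬r)))
    by {ℓ = lower} (yes r) o = trans (cong vert (above-lower {c} r o))
      (cong (λ t → par c , t ⊕ h (par c)) (sym (trans (cong (a ⊕_) (shift-root k r)) (⊕-0 a))))
    by {ℓ = upper} (yes r) o = trans (cong vert (above-upper {c} r o))
      (cong (λ t → par c , t ⊕ h (par c))
        (trans (⊖-⊕ a (k (par c))) (sym (trans (cong (a ⊕_) (shift-root k r)) (⊕-0 a)))))

  vert-beneath : ∀ c a → vert (beneath c a) ≡ (c , a ⊕ h c)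
  vert-beneath c a with own? a
  ... | no _ = refl
  ... | yes (x , start , _) = refl
  ... | yes (x , end , _) with x ≟F c
  ...   | yes _ = cong (λ t → c , t ⊕ h c) (⊖-⊕ a (k c))
  ...   | no _  = refl

  -- A root edge is deleted only when it starts at a lower cut point, so both roots keep their edges
  -- in a normal column.
  Normal : Fin p → Set
  Normal ζ = ∀ {x φ} → ¬ Own ζ x φ lower

  -- The role of the fibre edge starting at `ζ`: `split` is deleted by its owner `w`; `through c`
  -- and `marked c` are deleted, at an inner vertex and at a root respectively, by a path arriving
  -- from the child `c`; `column` is a root edge open to switching; `plain` is kept.
  data Status : Set where
    plain column split : Status
    through marked    : Fin n → Status

  data View (w : Fin n) (ζ : Fin p) : Status → Set where
    is-column  : Root w → Normal ζ → View w ζ column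
    is-marked  : ∀ {x φ c} → Root w → Own ζ x φ lower → Child c w → c ⊑ x → View w ζ (marked c)
    is-beside  : ∀ {x φ} → Root w → Own ζ x φ lower → ¬ Below w x → View w ζ plain
    is-split   : ∀ {ℓ} → ¬ Root w → Own ζ w start ℓ → View w ζ split
    is-through : ∀ {x φ ℓ c} → ¬ Root w → Own ζ x φ ℓ → Child c w → c ⊑ x → View w ζ (through c)
    is-inner   : ¬ Root w → (∀ {ℓ} → ¬ Own ζ w start ℓ) →
                 (∀ {x φ ℓ} → Own ζ x φ ℓ → ¬ Below w x) → View w ζ plain

  view : ∀ w ζ → ∃[ s ] View w ζ s
  view w ζ with root? w | own? ζ
  ... | yes r | no ¬o = _ , is-column r (λ o → ¬o (_ , _ , _ , o))
  ... | yes r | yes (x , φ , upper , o) = _ , is-column r normal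
    where
    normal : Normal ζ
    normal o′ with () ← proj₂ (proj₂ (own-unique o o′))
  ... | yes r | yes (x , φ , lower , o) with below? w x
  ...   | yes (c , child , c⊑x) = _ , is-marked r o child c⊑x
  ...   | no ¬b                 = _ , is-beside r o ¬b
  view w ζ | no ¬r | no ¬o =
    _ , is-inner ¬r (λ o → ¬o (_ , _ , _ , o)) (λ o _ → ¬o (_ , _ , _ , o))
  view w ζ | no ¬r | yes (x , φ , ℓ , o) with below? w x | x ≟F w | φ
  ... | yes (c , child , c⊑x) | _        | _     = _ , is-through ¬r o child c⊑x
  ... | no _                  | yes refl | start = _ , is-split ¬r o
  ... | no ¬b                 | yes refl | end   = _ , is-inner ¬r not-start not-below
    where
    not-start : ∀ {ℓ} → ¬ Own ζ w start ℓ
    not-start o′ with () ← proj₁ (proj₂ (own-unique o o′))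
    not-below : ∀ {x φ ℓ} → Own ζ x φ ℓ → ¬ Below w x
    not-below o′ with refl ← proj₁ (own-unique o o′) = ¬b
  ... | no ¬b                 | no x≢w   | _     =
    _ , is-inner ¬r (λ o′ → x≢w (proj₁ (own-unique o o′))) not-below
    where
    not-below : ∀ {x φ ℓ} → Own ζ x φ ℓ → ¬ Below w x
    not-below o′ with refl ← proj₁ (own-unique o o′) = ¬b

  status : Fin n → Fin p → Status
  status w ζ = proj₁ (view w ζ)

  -- The cases exclude each other, as a cut point has one owner, phase and level, and the owner lies
  -- below at most one child of `w`. So any evidence for a case determines the status.
  status-split : ∀ {w ζ ℓ} → ¬ Root w → Own ζ w start ℓ → status w ζ ≡ split
  status-split {w} {ζ} ¬r o with view w ζ
  ... | _ , is-column r _      = contradiction r ¬r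
  ... | _ , is-marked r _ _ _  = contradiction r ¬r
  ... | _ , is-beside r _ _    = contradiction r ¬r
  ... | _ , is-split _ _       = refl
  ... | _ , is-inner _ ¬s _    = contradiction o ¬s
  ... | _ , is-through _ o′ child c⊑x with refl ← proj₁ (own-unique o o′) =
    contradiction (_ , child , c⊑x) below-irrefl

  status-through : ∀ {w ζ x φ ℓ c} → ¬ Root w → Own ζ x φ ℓ → Child c w → c ⊑ x →
                   status w ζ ≡ through c
  status-through {w} {ζ} ¬r o child c⊑x with view w ζ
  ... | _ , is-column r _      = contradiction r ¬r
  ... | _ , is-marked r _ _ _  = contradiction r ¬r
  ... | _ , is-beside r _ _    = contradiction r ¬r
  ... | _ , is-inner _ _ ¬b    = contradiction (_ , child , c⊑x) (¬b o)
  ... | _ , is-split _ o′ with refl ← proj₁ (own-unique o o′) =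
    contradiction (_ , child , c⊑x) below-irrefl
  ... | _ , is-through _ o′ child′ c′⊑x with refl ← proj₁ (own-unique o o′) =
    cong through (child-unique child′ c′⊑x child c⊑x)

  status-marked : ∀ {w ζ x φ c} → Root w → Own ζ x φ lower → Child c w → c ⊑ x →
                  status w ζ ≡ marked c
  status-marked {w} {ζ} r o child c⊑x with view w ζ
  ... | _ , is-column _ normal  = contradiction o normal
  ... | _ , is-split ¬r _       = contradiction r ¬r
  ... | _ , is-through ¬r _ _ _ = contradiction r ¬r
  ... | _ , is-inner ¬r _ _     = contradiction r ¬r
  ... | _ , is-beside _ o′ ¬b with refl ← proj₁ (own-unique o o′) =
    contradiction (_ , child , c⊑x) ¬b
  ... | _ , is-marked _ o′ child′ c′⊑x with refl ← proj₁ (own-unique o o′) =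
    cong marked (child-unique child′ c′⊑x child c⊑x)

  status-column : ∀ {w ζ} → Root w → Normal ζ → status w ζ ≡ column
  status-column {w} {ζ} r normal with view w ζ
  ... | _ , is-column _ _       = refl
  ... | _ , is-marked _ o _ _   = contradiction o normal
  ... | _ , is-beside _ o _     = contradiction o normal
  ... | _ , is-split ¬r _       = contradiction r ¬r
  ... | _ , is-through ¬r _ _ _ = contradiction r ¬r
  ... | _ , is-inner ¬r _ _     = contradiction r ¬r

  module Switched (σ : Fin p → Bool) where

    move : Status → Dart → Dart
    move plain       (w , ζ , e)  = w , ζ , opposite e
    -- Both roots read the same bit, so the two edges of a column are switched together.
    move column      (w , ζ , e)  = if σ ζ then (other w , ζ , e) else (w , ζ , opposite e)
    move split       (w , ζ , lo) = above w ζ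
    move split       (w , ζ , hi) = above w (ζ ⊕ k w)
    move (through c) (w , ζ , lo) = above w ζ
    move (through c) (w , ζ , hi) = beneath c ζ
    move (marked c)  (w , ζ , lo) = beneath c ζ
    move (marked c)  (w , ζ , hi) = beneath c (ζ ⊕ k w)

    partner : Dart → Dart
    partner d@(w , ζ , _) = move (status w ζ) d

    partner-straight : ∀ {w ζ} e → Root w → Normal ζ → σ ζ ≡ false → partner (w , ζ , e) ≡ (w , ζ , opposite e)
    partner-straight {w} {ζ} e r normal eq rewrite status-column r normal | eq = refl

    partner-cross : ∀ {w ζ} e → Root w → Normal ζ → σ ζ ≡ true → partner (w , ζ , e) ≡ (other w , ζ , e)
    partner-cross {w} {ζ} e r normal eq rewrite status-column r normal | eq = refl

    -- Together with `partner-beneath` this says that the two ends of a rung choose each other, the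
    -- core of involutivity.
    partner-above : ∀ {c a x φ ℓ} → ¬ Root c → Own a x φ ℓ → c ⊑ x →
                    partner (above c a) ≡ beneath c a
    partner-above {c} {a} ¬c o c⊑x = by (root? (par c)) o c⊑x
      where
      by : ∀ {x φ ℓ} → Dec (Root (par c)) → Own a x φ ℓ → c ⊑ x → partner (above c a) ≡ beneath c a
      by (no ¬r) o c⊑x = trans (cong partner (above-inner {c} a ¬r))
        (cong (λ s → move s (par c , a , hi)) (status-through ¬r o (¬c , refl) c⊑x))
      -- At a root the status sits at the lower end of the deleted edge; an upper point is therefore
      -- first moved back by `K`.
      by {ℓ = lower} (yes r) o c⊑x = trans (cong partner (above-lower {c} r o))
        (cong (λ s → move s (par c , a , lo)) (status-marked r o (¬c , refl) c⊑x))
      by {ℓ = upper} (yes r) o c⊑x with upper⇒lower o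
      ... | _ , o′ = trans (cong partner (above-upper {c} r o))
        (trans (cong (λ s → move s (par c , a ⊖ k (par c) , hi))
                 (status-marked r (subst (λ t → Own (a ⊖ t) _ _ lower) (sym (k-root r)) o′) (¬c , refl) c⊑x))
               (cong (beneath c) (⊖-⊕ a (k (par c)))))

    -- Either a path from further below passes through `c`, or `c` itself owns the cut point.
    partner-beneath : ∀ {c a x φ ℓ} → ¬ Root c → Own a x φ ℓ → c ⊑ x →
                      partner (beneath c a) ≡ above c a
    partner-beneath {c} {a} ¬c o c⊑x with ⊑-below c⊑x
    ... | inj₂ (c′ , child , c′⊑x) =
      trans (cong partner (beneath-other o λ { refl → child⋢ child c′⊑x }))
        (cong (λ s → move s (c , a , lo)) (status-through ¬c o child c′⊑x))
    partner-beneath {c} {a} {φ = start} ¬c o c⊑x | inj₁ refl =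
      trans (cong partner (beneath-start o))
        (cong (λ s → move s (c , a , lo)) (status-split ¬c o))
    partner-beneath {c} {a} {φ = end} ¬c o c⊑x | inj₁ refl =
      trans (cong partner (beneath-end o))
        (trans (cong (λ s → move s (c , a ⊖ k c , hi)) (status-split ¬c (proj₂ (end⇒start o))))
               (cong (above c) (⊖-⊕ a (k c))))

    abstract
      involutive : ∀ d → partner (partner d) ≡ d
      involutive (w , ζ , e) = by e (proj₂ (view w ζ)) refl
        where
        uncut : ∀ e → status w ζ ≡ plain → partner (w , ζ , opposite e) ≡ (w , ζ , e)
        uncut e eq = trans (cong (λ s → move s (w , ζ , opposite e)) eq)
                           (cong (λ t → w , ζ , t) (opposite-involutive e))

        by : ∀ {s} e → View w ζ s → status w ζ ≡ s → partner (move s (w , ζ , e)) ≡ (w , ζ , e)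
        by lo (is-split ¬r o) _ = trans (partner-above ¬r o here) (beneath-start o)
        by hi (is-split ¬r o) _ with start⇒end o
        ... | _ , o′ = trans (partner-above ¬r o′ here)
          (trans (beneath-end o′) (cong (λ t → w , t , hi) (⊕-⊖ ζ (k w))))
        by lo (is-through ¬r o child c⊑x) _ =
          trans (partner-above ¬r o (below-⊑ ¬r (_ , child , c⊑x)))
                (beneath-other o λ { refl → child⋢ child c⊑x })
        by hi (is-through ¬r o (¬c , refl) c⊑x) _ =
          trans (partner-beneath ¬c o c⊑x) (above-inner ζ ¬r)
        by lo (is-marked r o (¬c , refl) c⊑x) _ =
          trans (partner-beneath ¬c o c⊑x) (above-lower r o)
        by hi (is-marked {c = c} r o (¬c , refl) c⊑x) _ with lower⇒upper o
        ... | _ , o′ =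
          let o″ = subst (λ t → Own (ζ ⊕ t) _ _ upper) (sym (k-root r)) o′ in
          trans (partner-beneath ¬c o″ c⊑x)
            (trans (above-upper {c} r o″) (cong (λ t → w , t , hi) (⊕-⊖ ζ (k w))))
        by e (is-column r normal) _ with σ ζ in σζ
        ... | false = trans (partner-straight (opposite e) r normal σζ)
                            (cong (λ t → w , ζ , t) (opposite-involutive e))
        ... | true  = trans (partner-cross e (other-root r) normal σζ)
                            (cong (λ t → t , ζ , e) (other-involutive r))
        by e (is-beside _ _ _) eq = uncut e eq
        by e (is-inner _ _ _)  eq = uncut e eq

    private
      opposite≢ : ∀ {w : Fin n} {ζ : Fin p} e → (w , ζ , opposite e) ≢ (w , ζ , e)
      opposite≢ lo ()
      opposite≢ hi ()

      par≢ : ∀ {c} → ¬ Root c → par c ≢ c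
      par≢ ¬r eq = <⇒≢ (rank-par ¬r) (cong rank eq)

    abstract
      irreflexive : ∀ d → partner d ≢ d
      irreflexive (w , ζ , e) eq with view w ζ
      irreflexive (w , ζ , lo) eq | _ , is-split ¬r o =
        par≢ ¬r (trans (sym (above-fibre w _)) (cong proj₁ eq))
      irreflexive (w , ζ , hi) eq | _ , is-split ¬r o =
        par≢ ¬r (trans (sym (above-fibre w _)) (cong proj₁ eq))
      irreflexive (w , ζ , lo) eq | _ , is-through ¬r o child c⊑x =
        par≢ ¬r (trans (sym (above-fibre w _)) (cong proj₁ eq))
      irreflexive (w , ζ , hi) eq | _ , is-through {c = c} ¬r o (¬c , refl) c⊑x =
        par≢ ¬c (sym (trans (sym (beneath-fibre c _)) (cong proj₁ eq)))
      irreflexive (w , ζ , lo) eq | _ , is-marked {c = c} r o (¬c , refl) c⊑x =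
        par≢ ¬c (sym (trans (sym (beneath-fibre c _)) (cong proj₁ eq)))
      irreflexive (w , ζ , hi) eq | _ , is-marked {c = c} r o (¬c , refl) c⊑x =
        par≢ ¬c (sym (trans (sym (beneath-fibre c _)) (cong proj₁ eq)))
      irreflexive (w , ζ , e) eq | _ , is-beside _ _ _ = opposite≢ e eq
      irreflexive (w , ζ , e) eq | _ , is-inner _ _ _  = opposite≢ e eq
      irreflexive (w , ζ , e) eq | _ , is-column r _ with σ ζ
      ... | true  = other≢ r (cong proj₁ eq)
      ... | false = opposite≢ e eq

    matching : Matching
    matching = record { partner = partner ; involutive = involutive ; irreflexive = irreflexive }

    module _ {Adj : Fin n × Fin p → Fin n × Fin p → Set}
      (adj-sym : ∀ {x y} → Adj x y → Adj y x)
      (fibre-adj : ∀ w a → Adj (w , a) (w , a ⊕ k w))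
      (rung-adj : ∀ {c} → ¬ Root c → ∀ a → Adj (c , a ⊕ h c) (par c , a ⊕ shift k (par c) ⊕ h (par c)))
      (cross-adj : ∀ a → Adj (v , a ⊕ h v) (u , a ⊕ h u)) where

      private
        adj-rung : ∀ {c a x φ ℓ} → ¬ Root c → Own a x φ ℓ → Adj (vert (beneath c a)) (vert (above c a))
        adj-rung {c} {a} ¬c o = subst₂ Adj (sym (vert-beneath c a)) (sym (vert-above o)) (rung-adj ¬c a)

        adj-row : ∀ w ζ → Adj (vert (w , ζ , lo)) (vert (w , ζ , hi))
        adj-row w ζ = subst (λ t → Adj (w , ζ ⊕ h w) (w , t)) (⊕-comm ζ (h w) (k w)) (fibre-adj w (ζ ⊕ h w))

        adj-cross : ∀ {w} → Root w → ∀ a → Adj (w , a ⊕ h w) (other w , a ⊕ h (other w))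
        adj-cross (inj₁ refl) a rewrite other-v = cross-adj a
        adj-cross (inj₂ refl) a rewrite other-u = adj-sym (cross-adj a)

        adj-plain : ∀ w ζ e → Adj (vert (w , ζ , e)) (vert (w , ζ , opposite e))
        adj-plain w ζ lo = adj-row w ζ
        adj-plain w ζ hi = adj-sym (adj-row w ζ)

      adj-partner : ∀ d → Adj (vert d) (vert (partner d))
      adj-partner (w , ζ , e) with view w ζ
      adj-partner (w , ζ , lo) | _ , is-split ¬r o =
        subst (λ t → Adj t (vert (above w ζ))) (vert-beneath w ζ) (adj-rung ¬r o)
      adj-partner (w , ζ , hi) | _ , is-split ¬r o =
        subst (λ t → Adj t (vert (above w (ζ ⊕ k w)))) (vert-beneath w (ζ ⊕ k w))
          (adj-rung ¬r (proj₂ (start⇒end o)))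
      adj-partner (w , ζ , lo) | _ , is-through ¬r o child c⊑x =
        subst (λ t → Adj t (vert (above w ζ))) (vert-beneath w ζ) (adj-rung ¬r o)
      adj-partner (w , ζ , hi) | _ , is-through {c = c} ¬r o (¬c , refl) c⊑x =
        adj-sym (subst (λ t → Adj (vert (beneath c ζ)) (vert t)) (above-inner ζ ¬r) (adj-rung ¬c o))
      adj-partner (w , ζ , lo) | _ , is-marked {c = c} r o (¬c , refl) c⊑x =
        adj-sym (subst (λ t → Adj (vert (beneath c ζ)) (vert t)) (above-lower r o) (adj-rung ¬c o))
      adj-partner (w , ζ , hi) | _ , is-marked {c = c} r o (¬c , refl) c⊑x with lower⇒upper o
      ... | _ , o′ = adj-sym (subst (λ t → Adj (vert (beneath c (ζ ⊕ k w))) t)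
          (trans (vert-above o″) (cong (λ t → w , t ⊕ h w)
            (trans (cong (ζ ⊕ k w ⊕_) (shift-root k r)) (⊕-0 (ζ ⊕ k w)))))
          (adj-rung ¬c o″))
        where o″ = subst (λ t → Own (ζ ⊕ t) _ _ upper) (sym (k-root r)) o′
      adj-partner (w , ζ , e) | _ , is-beside _ _ _ = adj-plain w ζ e
      adj-partner (w , ζ , e) | _ , is-inner _ _ _  = adj-plain w ζ e
      adj-partner (w , ζ , e) | _ , is-column r _ with σ ζ
      ... | false = adj-plain w ζ e
      adj-partner (w , ζ , lo) | _ , is-column r _ | true = adj-cross r ζ
      -- Equal steps at the two roots put the `hi` ends of both edges at the same coordinate, so a
      -- rung joins them too.
      adj-partner (w , ζ , hi) | _ , is-column r _ | true =
        subst (λ t → Adj (w , ζ ⊕ k w ⊕ h w) (other w , ζ ⊕ t ⊕ h (other w)))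
          (trans (k-root r) (sym (k-root (other-root r)))) (adj-cross r (ζ ⊕ k w))

  -- Merging cycles column by column

  ConnBy : (Fin p → Bool) → Dart → Dart → Set
  ConnBy σ = Matching.Conn (Switched.matching σ)

  normal? : ∀ ζ → Dec (Normal ζ)
  normal? ζ with own? ζ
  ... | no ¬o                     = yes (λ o → ¬o (_ , _ , _ , o))
  ... | yes (_ , _ , lower , o)   = no (λ normal → normal o)
  ... | yes (_ , _ , upper , o)   = yes normal
    where
    normal : Normal ζ
    normal o′ with () ← proj₂ (proj₂ (own-unique o o′))

  module Switch (σ : Fin p → Bool) {i : Fin p} (normal : Normal i)
    (separate : ¬ ConnBy σ (v , i , lo) (u , i , lo)) where

    private
      module S = Switched σ

      -- A switched column would already join the two darts by a rung.
      unswitched : σ i ≡ false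
      unswitched with σ i in eq
      ... | false = refl
      ... | true  = contradiction
        (subst (ConnBy σ (v , i , lo))
          (trans (S.partner-cross lo (inj₁ refl) normal eq) (cong (λ t → t , i , lo) other-v))
          (Matching.via-partner (Matching.stop {S.matching}))) separate

    switched : Fin p → Bool
    switched ζ = does (ζ ≟F i) ∨ σ ζ

    private
      module S′ = Switched switched

      away : ∀ {ζ} → ζ ≢ i → switched ζ ≡ σ ζ
      away {ζ} ζ≢i = cong (_∨ σ ζ) (dec-false (ζ ≟F i) ζ≢i)

      move-cong : ∀ s w ζ e → switched ζ ≡ σ ζ → S′.move s (w , ζ , e) ≡ S.move s (w , ζ , e)
      move-cong plain       w ζ e  eq = refl
      move-cong column      w ζ e  eq = cong (if_then (other w , ζ , e) else (w , ζ , opposite e)) eq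
      move-cong split       w ζ lo eq = refl
      move-cong split       w ζ hi eq = refl
      move-cong (through c) w ζ lo eq = refl
      move-cong (through c) w ζ hi eq = refl
      move-cong (marked c)  w ζ lo eq = refl
      move-cong (marked c)  w ζ hi eq = refl

      inner-cong : ∀ {s w ζ} e → View w ζ s → ¬ Root w → S′.move s (w , ζ , e) ≡ S.move s (w , ζ , e)
      inner-cong e  (is-column r _)      ¬r = contradiction r ¬r
      inner-cong e  (is-marked r _ _ _)  ¬r = contradiction r ¬r
      inner-cong e  (is-beside r _ _)    ¬r = contradiction r ¬r
      inner-cong lo (is-split _ _)       ¬r = refl
      inner-cong hi (is-split _ _)       ¬r = refl
      inner-cong lo (is-through _ _ _ _) ¬r = refl
      inner-cong hi (is-through _ _ _ _) ¬r = refl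
      inner-cong e  (is-inner _ _ _)     ¬r = refl

      straight : ∀ {w} → Root w → S.partner (w , i , lo) ≡ (w , i , hi)
      straight r = S.partner-straight lo r normal unswitched

      Outside : Dart → Set
      Outside d = d ≢ (v , i , lo) × d ≢ S.partner (v , i , lo) ×
                  d ≢ (u , i , lo) × d ≢ S.partner (u , i , lo)

      -- The four excluded darts are all the root darts of column `i`; in inner fibres `σ` is never
      -- read.
      outside-inner : ∀ {w e} → Outside (w , i , e) → ¬ Root w
      outside-inner {e = lo} (≢v , _) (inj₁ refl)           = ≢v refl
      outside-inner {e = hi} (_ , ≢pv , _) (inj₁ refl)      = ≢pv (sym (straight (inj₁ refl)))
      outside-inner {e = lo} (_ , _ , ≢u , _) (inj₂ refl)   = ≢u refl
      outside-inner {e = hi} (_ , _ , _ , ≢pu) (inj₂ refl)  = ≢pu (sym (straight (inj₂ refl)))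

      agree : ∀ d → Outside d → S′.partner d ≡ S.partner d
      agree (w , ζ , e) outside = by (ζ ≟F i) outside
        where
        by : Dec (ζ ≡ i) → Outside (w , ζ , e) → S′.partner (w , ζ , e) ≡ S.partner (w , ζ , e)
        by (no ζ≢i)   _       = move-cong (status w ζ) w ζ e (away ζ≢i)
        by (yes refl) outside = inner-cong e (proj₂ (view w ζ)) (outside-inner outside)

    conn-switched : ∀ {d e} → ConnBy σ d e → ConnBy switched d e
    conn-switched = switch-conn S.matching S′.matching separate
      (λ d ≢v ≢pv ≢u ≢pu → agree d (≢v , ≢pv , ≢u , ≢pu))

    joined : ConnBy switched (v , i , lo) (u , i , lo)
    joined = subst (ConnBy switched (v , i , lo))
      (trans (S′.partner-cross lo (inj₁ refl) normal (cong (_∨ σ i) (dec-true (i ≟F i) refl)))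
             (cong (λ t → t , i , lo) other-v))
      (Matching.via-partner (Matching.stop {S′.matching}))

  _≼_ : (σ σ′ : Fin p → Bool) → Set
  σ ≼ σ′ = ∀ {d e} → ConnBy σ d e → ConnBy σ′ d e

  Joined : (Fin p → Bool) → Fin p → Set
  Joined σ i = Normal i → ConnBy σ (v , i , lo) (u , i , lo)

  -- A column is switched only when its edges lie on different cycles; otherwise it is joined
  -- already, and switching could split a cycle.
  join-column : ∀ i σ → ∃[ σ′ ] (σ ≼ σ′ × Joined σ′ i)
  join-column i σ = by (normal? i) (Matching.Orbit.conn? (Switched.matching σ) (v , i , lo) (u , i , lo))
    where
    by : Dec (Normal i) → Dec (ConnBy σ (v , i , lo) (u , i , lo)) → ∃[ σ′ ] (σ ≼ σ′ × Joined σ′ i)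
    by (no ¬normal) _              = σ , (λ c → c) , λ normal → contradiction (λ {x φ} → normal {x} {φ}) ¬normal
    by (yes _)      (yes joined)   = σ , (λ c → c) , λ _ → joined
    by (yes normal) (no separate)  = switched , conn-switched , λ _ → joined
      where
      open Switch σ normal separate

  -- Connectivity only grows, so a column treated early stays joined.
  join-columns : ∀ is σ → ∃[ σ′ ] (σ ≼ σ′ × (∀ {i} → i ∈ is → Joined σ′ i))
  join-columns []       σ = σ , (λ c → c) , λ ()
  join-columns (i ∷ is) σ = first (join-column i σ)
    where
    Result : Set
    Result = ∃[ σ′ ] (σ ≼ σ′ × (∀ {j} → j ∈ i ∷ is → Joined σ′ j))

    first : ∃[ σ₁ ] (σ ≼ σ₁ × Joined σ₁ i) → Result
    first (σ₁ , σ≼σ₁ , joined) = others (join-columns is σ₁)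
      where
      others : ∃[ σ₂ ] (σ₁ ≼ σ₂ × (∀ {j} → j ∈ is → Joined σ₂ j)) → Result
      others (σ₂ , σ₁≼σ₂ , joins) = σ₂ , (λ c → σ₁≼σ₂ (σ≼σ₁ c)) , λ where
        (here refl)  normal → σ₁≼σ₂ (joined normal)
        (there j∈is) normal → joins j∈is normal

  -- Connectivity after all switches

  module Connectivity (p-prime : Prime p) (0<k : ∀ w → 0 < k w) (k<p : ∀ w → k w < p) where

    private
      none : Fin p → Bool
      none _ = false

      module S = Switched none

    σ : Fin p → Bool
    σ = proj₁ (join-columns (allFin p) none)

    open Matching (Switched.matching σ) using (Conn; stop; via-flip; conn-trans; conn-sym)

    private
      -- Connections of the unswitched matching survive, so steps along rows may be checked there
      -- even if the row edge was replaced later.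
      keep : ∀ {d e} → ConnBy none d e → Conn d e
      keep = proj₁ (proj₂ (join-columns (allFin p) none))

      via : ∀ {d e} → S.partner d ≡ e → Conn d e
      via {d} eq = keep (subst (ConnBy none d) eq (Matching.via-partner (Matching.stop {S.matching})))

      along : ∀ {w ζ} → S.partner (w , ζ , lo) ≡ (w , ζ , hi) → Conn (w , ζ , lo) (w , ζ ⊕ k w , lo)
      along eq = via-flip (via eq)

      root-step : ∀ {w} → Root w → ∀ {ζ} → S.partner (w , ζ , lo) ≡ (w , ζ , hi) →
                  Conn (w , ζ , lo) (w , ζ ⊕ K , lo)
      root-step {w} r {ζ} eq = subst (λ t → Conn (w , ζ , lo) (w , ζ ⊕ t , lo)) (k-root r) (along eq)

      normal-step : ∀ {w} → Root w → ∀ {ζ} → Normal ζ → Conn (w , ζ , lo) (w , ζ ⊕ K , lo)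
      normal-step r normal = root-step r (S.partner-straight lo r normal refl)

      rung-normal : ∀ {ζ} → Normal ζ → Conn (v , ζ , lo) (u , ζ , lo)
      rung-normal = proj₂ (proj₂ (join-columns (allFin p) none)) (∈-allFin _)

      -- A column with a cut borrows the rung of the preceding column, which is normal, going back
      -- in one root fibre and forward in the other.
      rung : ∀ ζ → Conn (v , ζ , lo) (u , ζ , lo)
      rung ζ with normal? ζ
      ... | yes normal = rung-normal normal
      ... | no ¬normal = conn-trans (conn-sym (back (inj₁ refl)))
                           (conn-trans (rung-normal before) (back (inj₂ refl)))
        where
        lower≢upper : ∀ {x y φ ψ} → Own ζ x φ lower → ¬ Own ζ y ψ upper
        lower≢upper o o′ with () ← proj₂ (proj₂ (own-unique o o′))

        before : Normal (ζ ⊖ K)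
        -- A lower point at `ζ ⊖ K` would make `ζ` an upper point, but it is a lower one.
        before o with lower⇒upper o
        ... | _ , o′ = ¬normal λ o″ → lower≢upper o″ (subst (λ t → Own t _ _ upper) (⊖-⊕ ζ K) o′)

        back : ∀ {w} → Root w → Conn (w , ζ ⊖ K , lo) (w , ζ , lo)
        back {w} r = subst (λ t → Conn (w , ζ ⊖ K , lo) (w , t , lo)) (⊖-⊕ ζ K) (normal-step r before)

      beside-step : ∀ {w} → Root w → ∀ {ζ x φ} → Own ζ x φ lower → ¬ Below w x →
                    Conn (w , ζ , lo) (w , ζ ⊕ K , lo)
      beside-step {w} r {ζ} o ¬b = root-step r (by (proj₂ (view w ζ)) refl)
        where
        by : ∀ {s} → View w ζ s → status w ζ ≡ s → S.partner (w , ζ , lo) ≡ (w , ζ , hi)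
        by (is-column _ normal) _ = contradiction o normal
        by (is-marked _ o′ child c⊑x) _ with refl ← proj₁ (own-unique o o′) =
          contradiction (_ , child , c⊑x) ¬b
        by (is-beside _ _ _) eq = cong (λ s → S.move s (w , ζ , lo)) eq
        by (is-split ¬r _) _ = contradiction r ¬r
        by (is-through ¬r _ _ _) _ = contradiction r ¬r
        by (is-inner ¬r _ _) _ = contradiction r ¬r

      v-step : ∀ ζ → Conn (v , ζ , lo) (v , ζ ⊕ K , lo)
      v-step ζ with own? ζ
      ... | no ¬o = normal-step (inj₁ refl) (λ o → ¬o (_ , _ , _ , o))
      ... | yes (x , φ , upper , o) = normal-step (inj₁ refl) normal
        where
        normal : Normal ζ
        normal o′ with () ← proj₂ (proj₂ (own-unique o o′))
      ... | yes (x , φ , lower , o) with below? v x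
      ...   | no ¬b = beside-step (inj₁ refl) o ¬b
      -- The edge is missing over `v`, hence present over `u`: cross, step there and cross back.
      ...   | yes b = conn-trans (rung ζ)
        (conn-trans (beside-step (inj₂ refl) o λ b′ → v≢u (root-unique (inj₁ refl) (inj₂ refl) b b′))
                    (conn-sym (rung (ζ ⊕ K))))

      base : Dart
      base = v , fzero , lo

      v-all : ∀ ζ → Conn base (v , ζ , lo)
      v-all = ⊕-closed⇒all (λ ζ → Conn base (v , ζ , lo)) (λ ζ c → conn-trans c (v-step ζ)) stop
        where
        open Generation p-prime (subst (0 <_) (k-root (inj₁ refl)) (0<k v)) (subst (_< p) (k-root (inj₁ refl)) (k<p v))

      both-ends : ∀ {w} → (∀ ζ → Conn base (w , ζ , lo)) → ∀ d → proj₁ d ≡ w → Conn base d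
      both-ends all (w , ζ , lo) refl = all ζ
      both-ends {w} all (w , ζ , hi) refl =
        subst (λ t → Conn base (w , t , hi)) (⊕-⊖ ζ (k w)) (via-flip (all (ζ ⊕ k w)))

      -- At a deleted edge of an inner fibre the `lo` end is always the one whose rung leads
      -- upwards.
      cut-or-row : ∀ {w} → ¬ Root w → ∀ ζ →
        S.partner (w , ζ , lo) ≡ (w , ζ , hi) ⊎ S.partner (w , ζ , lo) ≡ above w ζ
      cut-or-row {w} ¬r ζ with view w ζ
      ... | _ , is-column r _      = contradiction r ¬r
      ... | _ , is-marked r _ _ _  = contradiction r ¬r
      ... | _ , is-beside r _ _    = contradiction r ¬r
      ... | _ , is-split _ _       = inj₂ refl
      ... | _ , is-through _ _ _ _ = inj₂ refl
      ... | _ , is-inner _ _ _     = inj₁ refl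

      -- Induction down the forest. Going backwards round the fibre, each edge is either present, or
      -- deleted with its `lo` end tied to the parent fibre, which is already reached.
      fibre-all : ∀ {w} → Ascent w → ∀ ζ → Conn base (w , ζ , lo)
      fibre-all (top (inj₁ refl)) ζ = v-all ζ
      fibre-all (top (inj₂ refl)) ζ = conn-trans (v-all ζ) (rung ζ)
      fibre-all {w} (up ¬r ascent) = ⊖-closed⇒all (λ ζ → Conn base (w , ζ , lo)) closed first
        where
        open Generation p-prime (0<k w) (k<p w)

        from-above : ∀ {ζ} → S.partner (w , ζ , lo) ≡ above w ζ → Conn base (w , ζ , lo)
        from-above {ζ} eq =
          conn-trans (both-ends (fibre-all ascent) (above w ζ) (above-fibre w ζ)) (conn-sym (via eq))

        closed : ∀ ζ → Conn base (w , ζ ⊕ k w , lo) → Conn base (w , ζ , lo)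
        closed ζ c with cut-or-row ¬r ζ
        ... | inj₁ row = conn-trans c (conn-sym (along row))
        ... | inj₂ cut = from-above cut

        -- The cut made by `w` itself guarantees a first tie to the parent fibre.
        first : Conn base (w , proj₁ (own-start ¬r) , lo)
        first = from-above (cong (λ s → S.move s (w , _ , lo)) (status-split ¬r (proj₂ (own-start ¬r))))

    connected : ∀ d → Conn (v , fzero , lo) d
    connected d = both-ends (fibre-all (ascent (proj₁ d))) d refl

-- The covering graph

module Lift {n m : ℕ} (G : ReflexiveGraph n m) (p′ : ℕ) where

  open ReflexiveGraph G
  open Residues p′

  private
    p : ℕ
    p = suc p′

  arc-reverse : ∀ {x y s} → Arc G x y s → Arc G y x (- s)
  arc-reverse (inj₁ (e , eq , refl))               = inj₂ (inj₁ (e , eq , refl))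
  arc-reverse (inj₂ (inj₁ (e , eq , refl)))        = inj₁ (e , eq , neg-involutive (φe e))
  arc-reverse (inj₂ (inj₂ (inj₁ (refl , refl))))   = inj₂ (inj₂ (inj₂ (refl , refl)))
  arc-reverse {x} (inj₂ (inj₂ (inj₂ (refl , refl)))) = inj₂ (inj₂ (inj₁ (refl , neg-involutive (φl x))))

  lift-sym : ∀ x y → LiftAdj G p x y → LiftAdj G p y x
  lift-sym (_ , a) (_ , b) (s , arc , divisible) = - s , arc-reverse arc ,
    subst (p ∣_) (trans (sym (∣-i∣≡∣i∣ ((+ toℕ b - + toℕ a) - s))) (cong ∣_∣ (negated (+ toℕ a) (+ toℕ b) s))) divisible
    where
    open ℤSolver.+-*-Solver
    negated : ∀ a b s → - ((b - a) - s) ≡ (a - b) - (- s)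
    negated = solve 3 (λ a b s → :- ((b :- a) :- s) := (a :- b) :- (:- s)) refl

  -- The natural number `t` represents the voltage modulo `p`; the quotient `z` is corrected by the
  -- number of wrap-arounds in `a ⊕ t`.
  lift-⊕ : ∀ {x y s} t z → Arc G x y s → + t - s ≡ z ℤ.* + p → ∀ a → LiftAdj G p (x , a) (y , a ⊕ t)
  lift-⊕ {s = s} t z arc eq a = s , arc , divides ∣ z - + q ∣ (trans (cong ∣_∣ difference) (abs-* (z - + q) (+ p)))
    where
    open ≡-Reasoning
    open ℤSolver.+-*-Solver
    q = (toℕ a + t) / p
    r = toℕ (a ⊕ t)

    quotient : + toℕ a ℤ.+ + t ≡ + r ℤ.+ + q ℤ.* + p
    quotient = begin
      + toℕ a ℤ.+ + t            ≡⟨ pos-+ (toℕ a) t ⟨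
      + (toℕ a + t)              ≡⟨ cong +_ (m≡m%n+[m/n]*n (toℕ a + t) p) ⟩
      + ((toℕ a + t) % p + q * p) ≡⟨ cong (λ j → + (j + q * p)) (toℕ-⊕ a t) ⟨
      + (r + q * p)              ≡⟨ pos-+ r (q * p) ⟩
      + r ℤ.+ + (q * p)          ≡⟨ cong (λ j → + r ℤ.+ j) (pos-* q p) ⟩
      + r ℤ.+ + q ℤ.* + p        ∎

    difference : (+ r - + toℕ a) - s ≡ (z - + q) ℤ.* + p
    difference = begin
      (+ r - + toℕ a) - s
        ≡⟨ solve 4 (λ r a s w → (r :- a) :- s := (r :+ w) :- a :- s :- w) refl (+ r) (+ toℕ a) s (+ q ℤ.* + p) ⟩
      (+ r ℤ.+ + q ℤ.* + p) - + toℕ a - s - + q ℤ.* + p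
        ≡⟨ cong (λ j → j - + toℕ a - s - + q ℤ.* + p) quotient ⟨
      (+ toℕ a ℤ.+ + t) - + toℕ a - s - + q ℤ.* + p
        ≡⟨ solve 4 (λ a t s w → (a :+ t) :- a :- s :- w := (t :- s) :- w) refl (+ toℕ a) (+ t) s (+ q ℤ.* + p) ⟩
      (+ t - s) - + q ℤ.* + p
        ≡⟨ cong (λ j → j - + q ℤ.* + p) eq ⟩
      z ℤ.* + p - + q ℤ.* + p
        ≡⟨ solve 3 (λ z q p → z :* p :- q :* p := (z :- q) :* p) refl z (+ q) (+ p) ⟩
      (z - + q) ℤ.* + p ∎

  residue : ℤ → ℕ
  residue s = s %ℕ p

  lift-residue : ∀ {x y s} → Arc G x y s → ∀ a → LiftAdj G p (x , a) (y , a ⊕ residue s)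
  lift-residue {s = s} arc = lift-⊕ (residue s) (- (s /ℕ p)) arc
    (trans (cong (λ j → + residue s - j) (a≡a%ℕn+[a/ℕn]*n s p))
      (solve 3 (λ r q p → r :- (r :+ q :* p) := (:- q) :* p) refl (+ residue s) (s /ℕ p) (+ p)))
    where
    open ℤSolver.+-*-Solver

  lift-loop : ∀ {w t} → φl w ≡ + t → ∀ a → LiftAdj G p (w , a) (w , a ⊕ t)
  lift-loop {w} {t} eq = lift-⊕ t +0 (inj₂ (inj₂ (inj₁ (refl , refl))))
    (trans (cong (λ j → + t - j) eq) (solve 2 (λ t p → t :- t := con +0 :* p) refl (+ t) (+ p)))
    where
    open ℤSolver.+-*-Solver

  neighbour-arc : ∀ {x y} → Neighbour G x y → ∃[ s ] Arc G y x s
  neighbour-arc (e , inj₁ eq) = - φe e , inj₂ (inj₁ (e , eq , refl))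
  neighbour-arc (e , inj₂ eq) = φe e , inj₁ (e , eq , refl)

-- A one-vertex tree offers no second root, but its lift is a single fibre, which its loop already
-- turns into one cycle.
module OneFibre {n m : ℕ} (G : ReflexiveGraph n m) (p′ : ℕ) (p-prime : Prime (suc p′))
  (v : Fin n) (alone : ∀ w → w ≡ v) (k : Fin n → ℕ)
  (φ≡k : ∀ w → ReflexiveGraph.φl G w ≡ + k w) (0<k : ∀ w → 0 < k w) (k<p : ∀ w → k w < suc p′) where

  open Residues p′
  open FibreDarts p′ k (λ _ → 0)
  open Lift G p′

  private
    partner : Dart → Dart
    partner (w , ζ , e) = w , ζ , opposite e

    irreflexive : ∀ d → partner d ≢ d
    irreflexive (w , ζ , lo) ()
    irreflexive (w , ζ , hi) ()

    row : Matching
    row = record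
      { partner = partner
      ; involutive = λ { (w , ζ , e) → cong (λ t → w , ζ , t) (opposite-involutive e) }
      ; irreflexive = irreflexive
      }

    open Matching row using (Conn; stop; via-flip; via-partner; hamiltonian)

    adjacent : ∀ d → LiftAdj G (suc p′) (vert d) (vert (partner d))
    adjacent (w , ζ , lo) = subst (λ t → LiftAdj G (suc p′) (w , ζ ⊕ 0) (w , t))
      (⊕-comm ζ 0 (k w)) (lift-loop (φ≡k w) (ζ ⊕ 0))
    adjacent (w , ζ , hi) = lift-sym (vert (w , ζ , lo)) (vert (w , ζ , hi)) (adjacent (w , ζ , lo))

    connected-lo : ∀ ζ → Conn (v , fzero , lo) (v , ζ , lo)
    connected-lo = ⊕-closed⇒all (λ ζ → Conn (v , fzero , lo) (v , ζ , lo))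
      (λ ζ c → via-flip (via-partner c)) stop
      where
      open Generation p-prime (0<k v) (k<p v)

    connected : ∀ d → Conn (v , fzero , lo) d
    connected (w , ζ , e) with refl ← alone w = by e
      where
      by : ∀ e → Conn (v , fzero , lo) (v , ζ , e)
      by lo = connected-lo ζ
      by hi = via-partner (connected-lo ζ)

  fibre-hamiltonian : ∀ {x y z} → x ≢ y → y ≢ z → x ≢ z → Hamiltonian (Fin n × Fin (suc p′)) (LiftAdj G (suc p′))
  fibre-hamiltonian x≢y y≢z x≢z =
    hamiltonian adjacent vert-surjective x≢y y≢z x≢z (v , fzero , lo) connected

module TwoRoots {n m : ℕ} (G : ReflexiveGraph n m) (G-connected : Connected G) (v u : Fin n)
  (v≢u : v ≢ u) (adjacent : Neighbour G u v)
  (p′ : ℕ) (p-prime : Prime (suc p′)) (k : Fin n → ℕ)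
  (φ≡k : ∀ w → ReflexiveGraph.φl G w ≡ + k w) (0<k : ∀ w → 0 < k w) (same : k u ≡ k v)
  (B : ℕ) (k+K≤B : ∀ w → k w + k v ≤ B) (fits : n * suc B ≤ suc p′) (k<p : ∀ w → k w < suc p′) where

  private
    p : ℕ
    p = suc p′

  open Residues p′
  open Lift G p′
  open Roots v u
  open Spanning G G-connected v u
  open Blocks p′ root? k (k v) 0<k (0<k v) B k+K≤B fits
  open Forest v u par rank rank-par

  private
    k-root : ∀ {w} → Root w → k w ≡ k v
    k-root (inj₁ refl) = refl
    k-root (inj₂ refl) = same

    -- Total, with default voltage 0 at roots, so that it can enter the gain of the potential.
    parent-arc : ∀ c → ∃[ s ] (¬ Root c → Arc G (par c) c s)
    parent-arc c with root? c
    ... | yes r = +0 , λ ¬r → contradiction r ¬r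
    ... | no ¬r with neighbour-arc (par-adjacent ¬r)
    ...   | s , arc = s , λ _ → arc

    root-arc : ∃[ s ] Arc G v u s
    root-arc = neighbour-arc adjacent

    -- Chosen so that rungs between the two root fibres preserve the coordinate.
    base : Fin n → ℕ
    base w with w ≟F v
    ... | yes _ = 0
    ... | no _  = residue (proj₁ root-arc)

    base-v : base v ≡ 0
    base-v with v ≟F v
    ... | yes _ = refl
    ... | no ne = contradiction refl ne

    base-u : base u ≡ residue (proj₁ root-arc)
    base-u with u ≟F v
    ... | yes eq = contradiction (sym eq) v≢u
    ... | no _   = refl

  -- With this gain the rung at label `a` of `c` meets the parent fibre at `a` over a root and one
  -- fibre step further over an inner vertex.
  open Potential base (λ c → shift k (par c) + residue (proj₁ (parent-arc c)))
    renaming (potential to h; potential-root to h-root; potential-par to h-par)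

  private
    cross-adj : ∀ a → LiftAdj G p (v , a ⊕ h v) (u , a ⊕ h u)
    cross-adj a = subst₂ (λ s t → LiftAdj G p (v , s) (u , t))
      (sym (trans (cong (a ⊕_) (trans (h-root (inj₁ refl)) base-v)) (⊕-0 a)))
      (cong (a ⊕_) (sym (trans (h-root (inj₂ refl)) base-u)))
      (lift-residue (proj₂ root-arc) a)

    rung-adj : ∀ {c} → ¬ Root c → ∀ a →
               LiftAdj G p (c , a ⊕ h c) (par c , a ⊕ shift k (par c) ⊕ h (par c))
    rung-adj {c} ¬r a = lift-sym (par c , b) (c , a ⊕ h c) (subst (λ t → LiftAdj G p (par c , b) (c , t)) (begin
        b ⊕ t                                      ≡⟨ cong (_⊕ t) (⊕-comm a s (h (par c))) ⟩
        a ⊕ h (par c) ⊕ s ⊕ t                      ≡⟨ ⊕-⊕ (a ⊕ h (par c)) s t ⟩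
        a ⊕ h (par c) ⊕ (s + t)                    ≡⟨ ⊕-⊕ a (h (par c)) (s + t) ⟩
        a ⊕ (h (par c) + (s + t))                  ≡⟨ cong (a ⊕_) (h-par ¬r) ⟨
        a ⊕ h c                                    ∎) (lift-residue (proj₂ (parent-arc c) ¬r) b))
      where
      open ≡-Reasoning
      s = shift k (par c)
      t = residue (proj₁ (parent-arc c))
      b = a ⊕ s ⊕ h (par c)

  open FibreDarts p′ k h using (module Matching; vert-surjective)
  open Billiard p′ v u v≢u par rank rank-par k (k v) k-root layout h
  open Billiard.Connectivity p′ v u v≢u par rank rank-par k (k v) k-root layout h p-prime 0<k k<p using (σ; connected)

  billiard-hamiltonian : ∀ {x y z} → x ≢ y → y ≢ z → x ≢ z → Hamiltonian (Fin n × Fin p) (LiftAdj G p)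
  billiard-hamiltonian x≢y y≢z x≢z =
    Matching.hamiltonian (Switched.matching σ)
      (Switched.adj-partner σ {LiftAdj G p} (λ {x} {y} → lift-sym x y) (λ w → lift-loop (φ≡k w)) rung-adj cross-adj)
      vert-surjective x≢y y≢z x≢z (v , fzero , lo) connected

-- The bound on the prime and the second root

bounded : ∀ {n} (f : Fin n → ℕ) → ∃[ B ] (∀ i → f i ≤ B)
bounded {zero}  f = 0 , λ ()
bounded {suc n} f with bounded (f ∘ fsuc)
... | B , f≤B = f fzero + B , λ where
  fzero    → m≤m+n (f fzero) B
  (fsuc i) → ≤-trans (f≤B i) (m≤n+m B (f fzero))

first-neighbour : ∀ {n m} {G : ReflexiveGraph n m} → NoSelfEdges G → ∀ {v w es} → Walk G v w es → w ≢ v →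
                  ∃[ u ] (v ≢ u × Neighbour G u v)
first-neighbour noself nil w≢v = contradiction refl w≢v
first-neighbour {G = G} noself {v} (step {w = u} e joins _) _ = u , v≢u joins , e , swap joins
  where
  v≢u : Joins G e v u → v ≢ u
  v≢u (inj₁ eq) refl = noself e v eq
  v≢u (inj₂ eq) refl = noself e v eq
  swap : Joins G e v u → Joins G e u v
  swap (inj₁ eq) = inj₂ eq
  swap (inj₂ eq) = inj₁ eq

theorem3 : ∀ {n m : ℕ} (T : ReflexiveGraph n m) → IsReflexiveTree T →
    (∀ w → +0 ℤ.< ReflexiveGraph.φl T w) →
    (v : Fin n) → (∀ u → Neighbour T u v → ReflexiveGraph.φl T u ≡ ReflexiveGraph.φl T v) →
    ∃[ N ] (∀ (p : ℕ) → Prime p → N ≤ p → Hamiltonian (Fin n × Fin p) (LiftAdj T p))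
-- The summand `n * suc B` makes room for one block per vertex and keeps every step below `p`; the 3
-- supplies three distinct points of one fibre for the length condition.
theorem3 {n} T (noself , T-connected , _) positive v equal = 3 + n * suc B , hamiltonian-lift
  where
  open ReflexiveGraph T

  k : Fin n → ℕ
  k w = ∣ φl w ∣

  φ≡k : ∀ w → φl w ≡ + k w
  φ≡k w = sym (0≤i⇒+∣i∣≡i (ℤ<⇒≤ (positive w)))

  0<k : ∀ w → 0 < k w
  0<k w = drop‿+<+ (subst (+0 ℤ.<_) (φ≡k w) (positive w))

  B : ℕ
  B = proj₁ (bounded λ w → k w + k v)

  k+K≤B : ∀ w → k w + k v ≤ B
  k+K≤B = proj₂ (bounded λ w → k w + k v)

  hamiltonian-lift : ∀ p → Prime p → 3 + n * suc B ≤ p → Hamiltonian (Fin n × Fin p) (LiftAdj T p)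
  hamiltonian-lift (suc (suc (suc q))) p-prime (s≤s (s≤s (s≤s le))) = by (any? (λ w → ¬? (w ≟F v)))
    where
    p = suc (suc (suc q))

    fits : n * suc B ≤ p
    fits = ≤-trans le (m≤n+m q 3)

    k<p : ∀ w → k w < p
    k<p w = ≤-trans (s≤s (≤-trans (m≤m+n (k w) (k v)) (k+K≤B w)))
      (≤-trans (m≤n*m (suc B) n {{nonZeroIndex v}}) fits)

    0≢1 : (v , fzero {n = suc (suc q)}) ≢ (v , fsuc fzero)
    0≢1 ()

    1≢2 : (v , fsuc {n = suc (suc q)} fzero) ≢ (v , fsuc (fsuc fzero))
    1≢2 ()

    0≢2 : (v , fzero {n = suc (suc q)}) ≢ (v , fsuc (fsuc fzero))
    0≢2 ()

    by : Dec (∃[ w ] (w ≢ v)) → Hamiltonian (Fin n × Fin p) (LiftAdj T p)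
    by (no alone) = OneFibre.fibre-hamiltonian T (suc (suc q)) p-prime v
      (λ w → decidable-stable (w ≟F v) (λ w≢v → alone (w , w≢v))) k φ≡k 0<k k<p 0≢1 1≢2 0≢2
    by (yes (w , w≢v)) with first-neighbour noself (proj₂ (T-connected v w)) w≢v
    ... | u , v≢u , adjacent =
      TwoRoots.billiard-hamiltonian T T-connected v u v≢u adjacent (suc (suc q)) p-prime k φ≡k 0<k
        (cong ∣_∣ (equal u adjacent)) B k+K≤B fits k<p 0≢1 1≢2 0≢2
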